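{- Let $d\ge 1$, let $p$ be a fixed prime, and let $e=(\mathbf{e}_1,\dots,\mathbf{e}_u)$ and $f=(\mathbf{1}_{k_1},\dots,\mathbf{1}_{k_v})$ be disjoint tuples of vectors in $\mathbb{N}^d$ (with $k_i\in\{1,\dots,d\}$ for all $i$) such that $|e|=|f|$ and $e$ is $2$-admissible. Assume that the generating function $f_{\mathfrak{S}_{e,f}}(z)=\sum_{m\ge0}\mathfrak{S}_{e,f}(m)z^m$ is annihilated by a differential operator $\mathcal{L}\in\mathbb{Z}_p[z,\theta]$ such that at least one of the following holds: (i) $\mathcal{L}$ is of type I; (ii) $\mathcal{L}$ is of type II and $p-1\in\mathcal{Z}_p(\mathfrak{S}_{e,f})$. Then for all $n\in\mathbb{N}$ and all $g\in\mathfrak{F}_p^d$ we have $$\mathfrak{S}_{e,f}(n)\in p^{\alpha_p(\mathfrak{S}_{e,f},n)}\mathbb{Z}\quad\text{and}\quad \mathfrak{S}^g_{e,f}(n)\in p^{\alpha_p(\mathfrak{S}_{e,f},n)-1}\mathbb{Z}_p.$$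
   Context: $\mathbb{Z}_p$ denotes the $p$-adic integers. $\mathbf{1}_k\in\mathbb{N}^d$ is the vector with $1$ in coordinate $k$ and $0$ elsewhere; $\mathbf{1}=(1,\dots,1)$. For vectors, $\mathbf{m}\cdot\mathbf{n}$ is the usual dot product, $\mathbf{m}\ge\mathbf{n}$ means coordinatewise inequality. For a tuple $e=(\mathbf{e}_1,\dots,\mathbf{e}_u)$, $|e|=\sum_i\mathbf{e}_i$; for $\mathbf{n}\in\mathbb{N}^d$, $|\mathbf{n}|$ is the sum of its coordinates. "Disjoint" means no vector occurs both as a component of $e$ and of $f$. For tuples $e=(\mathbf{e}_1,\dots,\mathbf{e}_u)$, $f=(\mathbf{f}_1,\dots,\mathbf{f}_v)$ put $\mathcal{Q}_{e,f}(\mathbf{n})=\prod_{i=1}^u(\mathbf{e}_i\cdot\mathbf{n})!/\prod_{i=1}^v(\mathbf{f}_i\cdot\mathbf{n})!$, $\mathfrak{S}_{e,f}(m)=\sum_{\mathbf{n}\in\mathbb{N}^d,|\mathbf{n}|=m}\mathcal{Q}_{e,f}(\mathbf{n})$, and for a function $g$, $\mathfrak{S}^g_{e,f}(m)=\sum_{|\mathbf{n}|=m}\mathcal{Q}_{e,f}(\mathbf{n})g(\mathbf{n})$. $e$ is $r$-admissible if there is $s\in\{0,\dots,r\}$ such that: (a) $s=0$ or there exist indices $1\le i_1<\dots<i_s\le u$ with $\mathbf{e}_{i_j}\ge\mathbf{1}$ for all $j$; and (b) $s=r$ or, for every $k\in\{1,\dots,d\}$, there exist indices $1\le i_1<\dots<i_{r-s}\le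 u$ with $\mathbf{e}_{i_j}\ge d\,\mathbf{1}_k$ for all $j$. $\mathfrak{F}_p^d$ is the set of functions $g:\mathbb{N}^d\to\mathbb{Z}_p$ such that for every $K\in\mathbb{N}$ there is a sequence of polynomial functions with coefficients in $\mathbb{Z}_p$ converging pointwise ($p$-adically) to $g$ on $\{0,\dots,K\}^d$. For a $\mathbb{Z}_p$-valued sequence $A$, $\mathcal{Z}_p(A)$ is the set of $v\in\{0,\dots,p-1\}$ with $A(v)\in p\mathbb{Z}_p$, and for $n\in\mathbb{N}$ with base-$p$ expansion $n=\sum_{k=0}^N n_kp^k$ ($n_k\in\{0,\dots,p-1\}$, $n_N\neq0$; for $n=0$ the single digit $0$), $\alpha_p(A,n)$ is the number of $k$ with $n_k\in\mathcal{Z}_p(A)$. $\theta=z\frac{d}{dz}$. An operator $\mathcal{L}=\sum_{k=0}^q z^kP_k(\theta)$ with $P_k\in\mathbb{Z}_p[X]$ is of type I if $P_0(\mathbb{Z}_p^\times)\subset\mathbb{Z}_p^\times$ and $P_k(X)\in\prod_{i=1}^{k-1}(X+i)^2\,\mathbb{Z}_p[X]$ for all $k\in\{2,\dots,q\}$; it is of type II if $q=2$, $P_0(\mathbb{Z}_p^\times)\subset\mathbb{Z}_p^\times$ and $P_2(X)\in(X+1)\mathbb{Z}_p[X]$. -}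

module Defs where

open import Data.Nat as ℕ using (ℕ; zero; suc; _+_; _*_; _∸_; _^_; _≤_; _<_; NonZero)
open import Data.Nat.Properties using (m*n≢0; m^n≢0; _!≢0; _≤?_; _≟_)
open import Data.Nat.Base using (_!)
open import Data.Integer as ℤ using (ℤ; +_; -[1+_])
open import Data.Rational as ℚ using (ℚ; ↥_; ↧ₙ_)
open import Data.Fin as Fin using (Fin; toℕ; fromℕ<)
open import Data.Fin.Properties using () renaming (_≟_ to _≟F_)
open import Data.Vec as Vec using (Vec; []; _∷_; lookup; tabulate)
open import Data.List as List using (List; []; _∷_)
open import Data.Product using (Σ; ∃; _×_; _,_)
open import Relation.Nullary using (¬_; yes; no)
open import Relation.Binary.PropositionalEquality using (_≡_; _≢_)
open import Data.Nat.DivMod using (m%n<n)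

_·_ : ∀ {d} → Vec ℕ d → Vec ℕ d → ℕ
[] · [] = 0
(x ∷ xs) · (y ∷ ys) = x * y + xs · ys

∣_∣ᵥ : ∀ {d} → Vec ℕ d → ℕ
∣ n ∣ᵥ = Vec.sum n

scaledUnit : ∀ {d} → ℕ → Fin d → Vec ℕ d
scaledUnit c k = tabulate (λ i → helper (i ≟F k))
  where
  helper : ∀ {A : Set} {a b : A} → Relation.Nullary.Dec (a ≡ b) → ℕ
  helper (yes _) = c
  helper (no _)  = 0

𝟏_ : ∀ {d} → Fin d → Vec ℕ d
𝟏 k = scaledUnit 1 k

𝟏ᵥ : ∀ {d} → Vec ℕ d
𝟏ᵥ = Vec.replicate _ 1

_≥ᵥ_ : ∀ {d} → Vec ℕ d → Vec ℕ d → Set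
m ≥ᵥ n = ∀ i → lookup n i ≤ lookup m i

vsum : ∀ {d u} → Vec (Vec ℕ d) u → Vec ℕ d
vsum [] = Vec.replicate _ 0
vsum (x ∷ xs) = Vec.zipWith _+_ x (vsum xs)

unitTuple : ∀ {d v} → Vec (Fin d) v → Vec (Vec ℕ d) v
unitTuple ks = Vec.map 𝟏_ ks

Disjoint : ∀ {d u v} → Vec (Vec ℕ d) u → Vec (Vec ℕ d) v → Set
Disjoint e f = ∀ i j → lookup e i ≢ lookup f j

IncreasingIndices : ∀ {u} → (s : ℕ) → (Fin u → Set) → Set
IncreasingIndices {u} s P =
  Σ (Vec (Fin u) s) λ is →
    (∀ (a b : Fin s) → toℕ a < toℕ b → toℕ (lookup is a) < toℕ (lookup is b))
    × (∀ a → P (lookup is a))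

Admissible : ∀ {d u} → ℕ → Vec (Vec ℕ d) u → Set
Admissible {d} r e =
  Σ ℕ λ s → s ≤ r
    × (s ≡ 0 Data.Sum.⊎ IncreasingIndices s (λ i → lookup e i ≥ᵥ 𝟏ᵥ))
    × (s ≡ r Data.Sum.⊎
        (∀ (k : Fin d) → IncreasingIndices (r ∸ s) (λ i → lookup e i ≥ᵥ scaledUnit d k)))
  where import Data.Sum

compositions : (d m : ℕ) → List (Vec ℕ d)
compositions zero zero = [] ∷ []
compositions zero (suc m) = []
compositions (suc d) m =
  List.concatMap (λ i → List.map (i ∷_) (compositions d (m ∸ i))) (List.upTo (suc m))

prodFact : ∀ {u} → Vec ℕ u → ℕ
prodFact [] = 1
prodFact (x ∷ xs) = x ! * prodFact xs

prodFact≢0 : ∀ {u} (xs : Vec ℕ u) → NonZero (prodFact xs)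
prodFact≢0 [] = _
prodFact≢0 (x ∷ xs) = m*n≢0 (x !) (prodFact xs) {{x !≢0}} {{prodFact≢0 xs}}

QNum : ∀ {d u} → Vec (Vec ℕ d) u → Vec ℕ d → ℕ
QNum e n = prodFact (Vec.map (_· n) e)

QDen : ∀ {d v} → Vec (Vec ℕ d) v → Vec ℕ d → ℕ
QDen f n = prodFact (Vec.map (_· n) f)

QDen≢0 : ∀ {d v} (f : Vec (Vec ℕ d) v) n → NonZero (QDen f n)
QDen≢0 f n = prodFact≢0 (Vec.map (_· n) f)

𝒬 : ∀ {d u v} → Vec (Vec ℕ d) u → Vec (Vec ℕ d) v → Vec ℕ d → ℚ
𝒬 e f n = ℚ._/_ (+ QNum e n) (QDen f n) {{QDen≢0 f n}}

𝔖 : ∀ {d u v} → Vec (Vec ℕ d) u → Vec (Vec ℕ d) v → ℕ → ℚ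
𝔖 {d} e f m = List.foldr ℚ._+_ ℚ.0ℚ (List.map (𝒬 e f) (compositions d m))

-- p-adic integers, represented by their base-p digit streams.
-- x = Σ_i (x i) p^i.  Equality is pointwise equality of digits.

module _ (p : ℕ) .{{_ : NonZero p}} where

  ℤₚ : Set
  ℤₚ = ℕ → Fin p

  infix 4 _≈ₚ_
  _≈ₚ_ : ℤₚ → ℤₚ → Set
  x ≈ₚ y = ∀ i → x i ≡ y i

  approx : ℤₚ → ℕ → ℕ
  approx x zero = 0
  approx x (suc k) = approx x k + toℕ (x k) * p ^ k

  -- the p-adic integer whose reduction mod p^k is a k (mod p^k),
  -- for a compatible system a of residues
  fromApprox : (ℕ → ℕ) → ℤₚ
  fromApprox a i = fromℕ< (m%n<n (ℕ._/_ (a (suc i)) (p ^ i) {{m^n≢0 p i}}) p)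

  ιℕ : ℕ → ℤₚ
  ιℕ n = fromApprox (λ _ → n)

  0ₚ 1ₚ : ℤₚ
  0ₚ = ιℕ 0
  1ₚ = ιℕ 1

  infixl 6 _+ₚ_ _-ₚ_
  infixl 7 _*ₚ_
  _+ₚ_ : ℤₚ → ℤₚ → ℤₚ
  x +ₚ y = fromApprox (λ k → approx x k + approx y k)

  _*ₚ_ : ℤₚ → ℤₚ → ℤₚ
  x *ₚ y = fromApprox (λ k → approx x k * approx y k)

  -ₚ_ : ℤₚ → ℤₚ
  -ₚ x = fromApprox (λ k → p ^ k ∸ approx x k)

  _-ₚ_ : ℤₚ → ℤₚ → ℤₚ
  x -ₚ y = x +ₚ (-ₚ y)

  ιℤ : ℤ → ℤₚ
  ιℤ (+ n) = ιℕ n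
  ιℤ -[1+ n ] = -ₚ ιℕ (suc n)

  Unit : ℤₚ → Set
  Unit x = Σ ℤₚ λ y → x *ₚ y ≈ₚ 1ₚ

  _∈p^_ℤₚ : ℤₚ → ℕ → Set
  x ∈p^ j ℤₚ = Σ ℤₚ λ y → x ≈ₚ ιℕ (p ^ j) *ₚ y

  -- Elements of ℚ_p of the form x / D with x ∈ ℤ_p, D a positive integer

  record Frac : Set where
    constructor _/ₚ_
    field
      num : ℤₚ
      den : ℕ
  open Frac public

  0F : Frac
  0F = 0ₚ /ₚ 1

  _+F_ : Frac → Frac → Frac
  (x /ₚ a) +F (y /ₚ b) = (x *ₚ ιℕ b +ₚ y *ₚ ιℕ a) /ₚ (a * b)

  _⊙_ : ℤₚ → Frac → Frac
  c ⊙ (x /ₚ a) = (c *ₚ x) /ₚ a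

  ιℚ : ℚ → Frac
  ιℚ q = ιℤ (↥ q) /ₚ (↧ₙ q)

  IsZeroF : Frac → Set
  IsZeroF z = num z ≈ₚ 0ₚ

  _∈F-p^_ℤₚ : Frac → ℤ → Set
  (x /ₚ a) ∈F-p^ (+ k) ℤₚ = Σ ℤₚ λ y → x ≈ₚ ιℕ (a * p ^ k) *ₚ y
  (x /ₚ a) ∈F-p^ -[1+ k ] ℤₚ = Σ ℤₚ λ y → ιℕ (p ^ suc k) *ₚ x ≈ₚ ιℕ a *ₚ y

  𝔖ᵍ : ∀ {d u v} → Vec (Vec ℕ d) u → Vec (Vec ℕ d) v → (Vec ℕ d → ℤₚ) → ℕ → Frac
  𝔖ᵍ {d} e f g m =
    List.foldr _+F_ 0F
      (List.map (λ n → (ιℕ (QNum e n) *ₚ g n) /ₚ QDen f n) (compositions d m))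

  Poly : Set
  Poly = List ℤₚ

  evalP : Poly → ℤₚ → ℤₚ
  evalP [] x = 0ₚ
  evalP (c ∷ cs) x = c +ₚ x *ₚ evalP cs x

  coeff : Poly → ℕ → ℤₚ
  coeff [] _ = 0ₚ
  coeff (c ∷ cs) zero = c
  coeff (c ∷ cs) (suc j) = coeff cs j

  _≈P_ : Poly → Poly → Set
  P ≈P Q = ∀ j → coeff P j ≈ₚ coeff Q j

  addP : Poly → Poly → Poly
  addP [] Q = Q
  addP P [] = P
  addP (a ∷ P) (b ∷ Q) = (a +ₚ b) ∷ addP P Q

  mulP : Poly → Poly → Poly
  mulP [] Q = []
  mulP (a ∷ P) Q = addP (List.map (a *ₚ_) Q) (0ₚ ∷ mulP P Q)

  X+ : ℕ → Poly
  X+ i = ιℕ i ∷ 1ₚ ∷ []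

  prodSq : ℕ → Poly
  prodSq k = List.foldr (λ i acc → mulP (mulP (X+ i) (X+ i)) acc) (1ₚ ∷ [])
                        (List.applyUpTo suc (k ∸ 1))

  _∈ideal_ : Poly → Poly → Set
  P ∈ideal G = Σ Poly λ Q → P ≈P mulP G Q

  -- Differential operators  𝓛 = Σ_{k=0}^q z^k P_k(θ)  with P_k ∈ ℤ_p[X].
  -- Action on a power series F(z) = Σ F(m) z^m:
  --   coefficient of z^N in 𝓛F  =  Σ_{0≤k≤min(q,N)} P_k(N-k) F(N-k).

  applyOp : (q : ℕ) → (Fin (suc q) → Poly) → (ℕ → Frac) → ℕ → Frac
  applyOp q P F N = List.foldr _+F_ 0F (List.map term (List.allFin (suc q)))
    where
    term : Fin (suc q) → Frac
    term k with toℕ k ≤? N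
    ... | yes _ = evalP (P k) (ιℕ (N ∸ toℕ k)) ⊙ F (N ∸ toℕ k)
    ... | no _  = 0F

  Annihilates : (q : ℕ) → (Fin (suc q) → Poly) → (ℕ → Frac) → Set
  Annihilates q P F = ∀ N → IsZeroF (applyOp q P F N)

  P₀UnitCondition : (q : ℕ) → (Fin (suc q) → Poly) → Set
  P₀UnitCondition q P = ∀ x → Unit x → Unit (evalP (P Fin.zero) x)

  TypeI : (q : ℕ) → (Fin (suc q) → Poly) → Set
  TypeI q P = P₀UnitCondition q P
    × (∀ (k : Fin (suc q)) → 2 ≤ toℕ k → P k ∈ideal prodSq (toℕ k))

  TypeII : (q : ℕ) → (Fin (suc q) → Poly) → Set
  TypeII q P = q ≡ 2 × P₀UnitCondition q P
    × (∀ (k : Fin (suc q)) → toℕ k ≡ 2 → P k ∈ideal X+ 1)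

  MPoly : ℕ → Set
  MPoly d = List (ℤₚ × Vec ℕ d)

  monomial : ∀ {d} → Vec ℕ d → Vec ℕ d → ℕ
  monomial [] [] = 1
  monomial (a ∷ as) (x ∷ xs) = x ^ a * monomial as xs

  evalM : ∀ {d} → MPoly d → Vec ℕ d → ℤₚ
  evalM [] n = 0ₚ
  evalM ((c , a) ∷ P) n = c *ₚ ιℕ (monomial a n) +ₚ evalM P n

  InF : (d : ℕ) → (Vec ℕ d → ℤₚ) → Set
  InF d g = ∀ (K : ℕ) → Σ (ℕ → MPoly d) λ Ps →
    ∀ (n : Vec ℕ d) → (∀ i → lookup n i ≤ K) →
      ∀ (t : ℕ) → Σ ℕ λ J → ∀ j → J ≤ j → (evalM (Ps j) n -ₚ g n) ∈p^ t ℤₚ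

  digitsAux : ℕ → ℕ → List ℕ
  digitsAux zero _ = []
  digitsAux (suc fuel) zero = []
  digitsAux (suc fuel) (suc m) =
    ℕ._%_ (suc m) p ∷ digitsAux fuel (ℕ._/_ (suc m) p)

  digits : ℕ → List ℕ
  digits zero = 0 ∷ []
  digits (suc m) = digitsAux (suc m) (suc m)

  In𝒵 : (ℕ → Frac) → ℕ → Set
  In𝒵 A v = v < p × (A v ∈F-p^ (+ 1) ℤₚ)

  data Count (P : ℕ → Set) : List ℕ → ℕ → Set where
    cnil : Count P [] 0
    cyes : ∀ {x xs k} → P x → Count P xs k → Count P (x ∷ xs) (suc k)
    cno  : ∀ {x xs k} → ¬ P x → Count P xs k → Count P (x ∷ xs) k

  αₚ≡ : (ℕ → Frac) → ℕ → ℕ → Set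
  αₚ≡ A n a = Count (In𝒵 A) (digits n) a

{-# OPTIONS --safe #-}
module Submission where

-- Split a vector x of weight v + n p into digits, x = a + p y. Then Q(x) / Q(y) is a p-adically
-- 1-Lipschitz function of y, divisible by p ^ t when |a| = v' + t p with v' < p, because some e_i
-- satisfies e_i · a ≥ |a|. Writing α(n) for the number of base-p digits of n in 𝒵_p(𝔖) and using
-- α(n + t) ≤ t + α(⌊n/p⌋) for t ≥ 1, one proves by simultaneous induction that p ^ α(⌊n/p⌋) divides
-- 𝔖^g(n) for every 1-Lipschitz weight g, and that p ^ α(n) divides 𝔖(n). The first claim gives the
-- second unless the last digit v of the argument lies in 𝒵_p(𝔖). In that case the differential
-- operator is used: modulo p ^ (α(n) + 1), the values 𝔖(w + n p) with 0 ≤ w < p satisfy the recurrence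
-- of the 𝔖(w), the remaining terms being killed by the divisibility conditions of type I or II,
-- so that 𝔖(w + n p) ≡ 𝔖(w) 𝔖(n p).
-- All p-adic quantities are handled through their residues modulo p ^ k in ℕ.

open import Defs
open import Data.Nat renaming (_/_ to _/ℕ_)
open import Data.Nat.Properties
open import Data.Nat.Divisibility
open import Data.Nat.DivMod using (m≡m%n+[m/n]*n; m%n<n; m%n≤m; m<n⇒m%n≡m; m<n⇒m/n≡0; /-mono-≤; 0/n≡0; m/n<m; [m+kn]%n≡m%n; +-distrib-/-∣ʳ; m*n/n≡m; m<n*o⇒m/o<n)
open import Data.Nat.Induction using (<-rec)
open import Data.Nat.Primality using (Prime; prime⇒irreducible; prime⇒nonTrivial; euclidsLemma)
open import Data.Nat.Coprimality using (Coprime; coprime-divisor; coprime-Bézout; 1-coprimeTo) renaming (sym to coprime-sym)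
open import Data.Nat.Combinatorics using (k![n∸k]!∣n!)
open import Data.Nat.GCD using (module Bézout)
open import Data.Nat.Tactic.RingSolver using (solve-∀)
open import Data.Fin as Fin using (Fin; toℕ)
open import Data.Fin.Properties using (toℕ<n; toℕ-fromℕ<; toℕ-injective) renaming (_≟_ to _≟F_)
open import Data.Vec as Vec using (Vec; []; _∷_; lookup)
open import Data.Vec.Properties using (tabulate-cong; tabulate∘lookup; lookup∘tabulate)
open import Data.Vec.Relation.Unary.All using (All; []; _∷_)
open import Data.Vec.Relation.Unary.All.Properties using (lookup⁺)
open import Data.List as List using (List; []; _∷_)
open import Data.Product using (Σ; _×_; _,_; proj₁; proj₂)
open import Data.Sum as Sum using (_⊎_; inj₁; inj₂)
open import Data.Empty using (⊥-elim)
open import Function using (_∘_; _∋_)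
open import Relation.Nullary using (¬_; yes; no)
open import Relation.Binary.PropositionalEquality

-- Congruences of natural numbers

-- Arbitrary weights enter because splitting off a digit puts a non-constant factor next to `Q`.
-- Limits of integral polynomials are replaced by 1-Lipschitz functions, a class that contains the
-- ratios of unit parts and that is kept when a contracting function is reduced to its quotient by
-- `p`. The delicate case is t = 0. There the step to v + n p needs p ^ α(n), while the weighted
-- claim at n yields only p ^ α(⌊n/p⌋), which may be one factor short. But then the weight
-- contracts: a change of its argument by a multiple of p ^ k changes it by a multiple of p ^ (k +
-- 1). So it has the form c + p h with h Lipschitz one level lower; the plain claim at n treats c,
-- and the factor p makes up the loss for h. This is why the two claims are proved together.

infix 4 _≅_[_]

-- Multiples of `m` are added on both sides since ℕ has no negatives; symmetry is then an exchange,
-- and the compatibility lemmas are semiring identities.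
record _≅_[_] (a b m : ℕ) : Set where
  constructor shifts
  field
    shiftˡ shiftʳ : ℕ
    shifted       : a + shiftˡ * m ≡ b + shiftʳ * m

≅-reflexive : ∀ {m a b} → a ≡ b → a ≅ b [ m ]
≅-reflexive eq = shifts 0 0 (cong (_+ 0) eq)

≅-refl : ∀ {m a} → a ≅ a [ m ]
≅-refl = ≅-reflexive refl

≅-sym : ∀ {m a b} → a ≅ b [ m ] → b ≅ a [ m ]
≅-sym (shifts x y eq) = shifts y x (sym eq)

≅-trans : ∀ {m a b c} → a ≅ b [ m ] → b ≅ c [ m ] → a ≅ c [ m ]
≅-trans {m} {a} {b} {c} (shifts x y eq) (shifts x' y' eq') = shifts (x + x') (y + y') (begin
  a + (x + x') * m     ≡⟨ ring₁ a x x' m ⟩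
  (a + x * m) + x' * m ≡⟨ cong (_+ x' * m) eq ⟩
  (b + y * m) + x' * m ≡⟨ ring₂ b y x' m ⟩
  (b + x' * m) + y * m ≡⟨ cong (_+ y * m) eq' ⟩
  (c + y' * m) + y * m ≡⟨ ring₃ c y' y m ⟩
  c + (y + y') * m     ∎)
  where
  open ≡-Reasoning
  ring₁ : ∀ a x y m → a + (x + y) * m ≡ (a + x * m) + y * m
  ring₁ = solve-∀
  ring₂ : ∀ a x y m → (a + x * m) + y * m ≡ (a + y * m) + x * m
  ring₂ = solve-∀
  ring₃ : ∀ a x y m → (a + x * m) + y * m ≡ a + (y + x) * m
  ring₃ = solve-∀

≅-+ : ∀ {m a b c d} → a ≅ b [ m ] → c ≅ d [ m ] → a + c ≅ b + d [ m ]
≅-+ {m} {a} {b} {c} {d} (shifts x y eq) (shifts x' y' eq') = shifts (x + x') (y + y')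
  (trans (ring a c x x' m) (trans (cong₂ _+_ eq eq') (sym (ring b d y y' m))))
  where
  ring : ∀ a c x y m → (a + c) + (x + y) * m ≡ (a + x * m) + (c + y * m)
  ring = solve-∀

≅-* : ∀ {m a b c d} → a ≅ b [ m ] → c ≅ d [ m ] → a * c ≅ b * d [ m ]
≅-* {m} {a} {b} {c} {d} (shifts x y eq) (shifts x' y' eq') =
  shifts (a * x' + x * c + x * x' * m) (b * y' + y * d + y * y' * m)
    (trans (ring a c x x' m) (trans (cong₂ _*_ eq eq') (sym (ring b d y y' m))))
  where
  ring : ∀ a c x y m → a * c + (a * y + x * c + x * y * m) * m ≡ (a + x * m) * (c + y * m)
  ring = solve-∀

≅-*ˡ : ∀ {m a b} c → a ≅ b [ m ] → c * a ≅ c * b [ m ]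
≅-*ˡ c = ≅-* (≅-refl {a = c})

≅-*ʳ : ∀ {m a b} c → a ≅ b [ m ] → a * c ≅ b * c [ m ]
≅-*ʳ c a≅b = ≅-* a≅b (≅-refl {a = c})

≅-^ : ∀ {m a b} k → a ≅ b [ m ] → a ^ k ≅ b ^ k [ m ]
≅-^ zero    _   = ≅-refl
≅-^ (suc k) a≅b = ≅-* a≅b (≅-^ k a≅b)

≅-cancel-+ : ∀ {m a b} c → c + a ≅ c + b [ m ] → a ≅ b [ m ]
≅-cancel-+ {m} {a} {b} c (shifts x y eq) = shifts x y (+-cancelˡ-≡ c _ _
  (trans (sym (+-assoc c a (x * m))) (trans eq (+-assoc c b (y * m)))))

≅-cancelʳ-+ : ∀ {m a b c d} → c ≅ d [ m ] → a + c ≅ b + d [ m ] → a ≅ b [ m ]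
≅-cancelʳ-+ {m} {a} {b} {c} {d} c≅d eq = ≅-cancel-+ d
  (≅-trans (≅-reflexive (+-comm d a))
    (≅-trans (≅-+ (≅-refl {a = a}) (≅-sym c≅d)) (≅-trans eq (≅-reflexive (+-comm b d)))))

≅-scale : ∀ {m a b} c → a ≅ b [ m ] → c * a ≅ c * b [ c * m ]
≅-scale {m} {a} {b} c (shifts x y eq) = shifts x y
  (trans (ring c a x m) (trans (cong (c *_) eq) (sym (ring c b y m))))
  where
  ring : ∀ c a x m → c * a + x * (c * m) ≡ c * (a + x * m)
  ring = solve-∀

≅-unscale : ∀ {m a b} c .{{_ : NonZero c}} → c * a ≅ c * b [ c * m ] → a ≅ b [ m ]
≅-unscale {m} {a} {b} c (shifts x y eq) = shifts x y (*-cancelˡ-≡ _ _ c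
  (trans (sym (ring c a x m)) (trans eq (ring c b y m))))
  where
  ring : ∀ c a x m → c * a + x * (c * m) ≡ c * (a + x * m)
  ring = solve-∀

≅-weaken : ∀ {m n a b} → n ∣ m → a ≅ b [ m ] → a ≅ b [ n ]
≅-weaken {n = n} {a} {b} (divides q refl) (shifts x y eq) = shifts (x * q) (y * q)
  (trans (cong (a +_) (*-assoc x q n)) (trans eq (cong (b +_) (sym (*-assoc y q n)))))

≅-mod1 : ∀ {a b} → a ≅ b [ 1 ]
≅-mod1 {a} {b} = shifts b a (ring a b)
  where
  ring : ∀ a b → a + b * 1 ≡ b + a * 1
  ring = solve-∀

∣⇒≅0 : ∀ {m a} → m ∣ a → a ≅ 0 [ m ]
∣⇒≅0 {m} {a} (divides q eq) = shifts 0 q (trans (+-identityʳ a) eq)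

≅∣ : ∀ {m a b} → a ≅ b [ m ] → m ∣ b → m ∣ a
≅∣ {m} {a} {b} (shifts x y eq) m∣b = ∣m+n∣m⇒∣n
  (subst (m ∣_) (trans (sym eq) (+-comm a (x * m))) (∣m∣n⇒∣m+n m∣b (n∣m*n y)))
  (n∣m*n x)

≅0⇒∣ : ∀ {m a} → a ≅ 0 [ m ] → m ∣ a
≅0⇒∣ {m} eq = ≅∣ eq (m ∣0)

private
  ≅⇒≤ : ∀ {m a b x y} → b < m → a + x * m ≡ b + y * m → x ≤ y
  ≅⇒≤ {m} {a} {b} {x} {y} b<m eq = ≮⇒≥ λ y<x → <⇒≢ (begin-strict
    b + y * m <⟨ +-monoˡ-< (y * m) b<m ⟩
    suc y * m ≤⟨ *-monoˡ-≤ m y<x ⟩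
    x * m     ≤⟨ m≤n+m (x * m) a ⟩
    a + x * m ∎) (sym eq)
    where open ≤-Reasoning

≅⇒≡ : ∀ {m a b} → a < m → b < m → a ≅ b [ m ] → a ≡ b
≅⇒≡ {m} {a} {b} a<m b<m (shifts x y eq)
  with refl ← ≤-antisym (≅⇒≤ {x = x} {y} b<m eq) (≅⇒≤ {x = y} {x} a<m (sym eq)) = +-cancelʳ-≡ _ a b eq

-- Coefficients known only modulo `p` suffice one level higher when they multiply values divisible
-- by `p ^ j`. This is the gain of one factor in `lucas`.
≅-lift : ∀ {p x y a} j → x ≅ y [ p ] → p ^ j ∣ a → x * a ≅ y * a [ p ^ suc j ]
≅-lift {p} {x} {y} j x≅y (divides q refl) =
  ≅-trans (≅-reflexive (ring x q (p ^ j)))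
    (≅-trans (≅-weaken (∣-reflexive (*-comm p (p ^ j))) (≅-scale (p ^ j) (≅-*ˡ q x≅y)))
      (≅-reflexive (sym (ring y q (p ^ j)))))
  where
  ring : ∀ x q r → x * (q * r) ≡ r * (q * x)
  ring = solve-∀

^-∣ : ∀ p {i j} → i ≤ j → p ^ i ∣ p ^ j
^-∣ p {i} {j} i≤j = divides (p ^ (j ∸ i))
  (trans (cong (p ^_) (sym (m∸n+n≡m i≤j))) (^-distribˡ-+-* p (j ∸ i) i))

module _ {p : ℕ} (pr : Prime p) where

  ∤⇒coprime : ∀ {x} → ¬ p ∣ x → Coprime x p
  ∤⇒coprime p∤x (d∣x , d∣p) with prime⇒irreducible pr d∣p
  ... | inj₁ d≡1 = d≡1
  ... | inj₂ refl = ⊥-elim (p∤x d∣x)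

  ∤⇒coprime-^ : ∀ {x} → ¬ p ∣ x → ∀ j → Coprime x (p ^ j)
  ∤⇒coprime-^ p∤x zero    (_ , d∣1)     = ∣1⇒≡1 d∣1
  ∤⇒coprime-^ p∤x (suc j) (d∣x , d∣pp^j) = ∤⇒coprime-^ p∤x j
    (d∣x , coprime-divisor (λ (c∣d , c∣p) → ∤⇒coprime p∤x (∣-trans c∣d d∣x , c∣p)) d∣pp^j)

  abstract
    inverse : ∀ {x} → ¬ p ∣ x → ∀ j → Σ ℕ λ y → x * y ≅ 1 [ p ^ j ]
    inverse {x} p∤x j with coprime-Bézout (∤⇒coprime-^ p∤x j)
    ... | Bézout.+- a b eq = a , shifts 0 b (trans (+-identityʳ _) (trans (*-comm x a) (sym eq)))
    -- here x * a ≡ -1, and the inverse is x * a * a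
    ... | Bézout.-+ a b eq = x * a * a , shifts (2 * b) (b * b * m) (begin
        x * (x * a * a) + (2 * b) * m     ≡⟨ ring₁ x a b m ⟩
        a * x * (a * x) + 2 * (b * m)     ≡⟨ cong (λ t → a * x * (a * x) + 2 * t) eq ⟨
        a * x * (a * x) + 2 * (1 + a * x) ≡⟨ ring₂ (a * x) ⟩
        1 + (1 + a * x) * (1 + a * x)     ≡⟨ cong (λ t → 1 + t * t) eq ⟩
        1 + b * m * (b * m)               ≡⟨ ring₃ b m ⟩
        1 + b * b * m * m                 ∎)
      where
      open ≡-Reasoning
      m : ℕ
      m = p ^ j
      ring₁ : ∀ x a b m → x * (x * a * a) + (2 * b) * m ≡ a * x * (a * x) + 2 * (b * m)
      ring₁ = solve-∀
      ring₂ : ∀ t → t * t + 2 * (1 + t) ≡ 1 + (1 + t) * (1 + t)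
      ring₂ = solve-∀
      ring₃ : ∀ b m → 1 + b * m * (b * m) ≡ 1 + b * b * m * m
      ring₃ = solve-∀

≅-cancel-unit : ∀ {m y a b} x → x * y ≅ 1 [ m ] → x * a ≅ x * b [ m ] → a ≅ b [ m ]
≅-cancel-unit {m} {y} {a} {b} x xy≅1 xa≅xb = ≅-trans (≅-sym (absorb a)) (≅-trans (≅-*ˡ y xa≅xb) (absorb b))
  where
  ring : ∀ x y a → y * (x * a) ≡ (x * y) * a
  ring = solve-∀
  absorb : ∀ c → y * (x * c) ≅ c [ m ]
  absorb c = ≅-trans (≅-reflexive (ring x y c))
    (≅-trans (≅-*ʳ c xy≅1) (≅-reflexive (*-identityˡ c)))

-- Finite sums over intervals and boxes

∑ : ℕ → (ℕ → ℕ) → ℕ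
∑ zero    f = 0
∑ (suc n) f = f 0 + ∑ n (λ i → f (suc i))

∑-cong : ∀ n {f g : ℕ → ℕ} → (∀ i → i < n → f i ≡ g i) → ∑ n f ≡ ∑ n g
∑-cong zero    eq = refl
∑-cong (suc n) eq = cong₂ _+_ (eq 0 z<s) (∑-cong n (λ i i<n → eq (suc i) (s<s i<n)))

∑-≅ : ∀ {m} n {f g : ℕ → ℕ} → (∀ i → i < n → f i ≅ g i [ m ]) → ∑ n f ≅ ∑ n g [ m ]
∑-≅ zero    eq = ≅-refl
∑-≅ (suc n) eq = ≅-+ (eq 0 z<s) (∑-≅ n (λ i i<n → eq (suc i) (s<s i<n)))

∑-zero : ∀ n → ∑ n (λ _ → 0) ≡ 0
∑-zero zero    = refl
∑-zero (suc n) = ∑-zero n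

∑-+ : ∀ n f g → ∑ n (λ i → f i + g i) ≡ ∑ n f + ∑ n g
∑-+ zero    f g = refl
∑-+ (suc n) f g = trans (cong (f 0 + g 0 +_) (∑-+ n _ _))
  (ring (f 0) (g 0) (∑ n (λ i → f (suc i))) (∑ n (λ i → g (suc i))))
  where
  ring : ∀ a b c d → (a + b) + (c + d) ≡ (a + c) + (b + d)
  ring = solve-∀

∑-*ˡ : ∀ n c f → ∑ n (λ i → c * f i) ≡ c * ∑ n f
∑-*ˡ zero    c f = sym (*-zeroʳ c)
∑-*ˡ (suc n) c f = trans (cong (c * f 0 +_) (∑-*ˡ n c _)) (sym (*-distribˡ-+ c (f 0) _))

∑-append : ∀ m n f → ∑ (m + n) f ≡ ∑ m f + ∑ n (λ i → f (m + i))
∑-append zero    n f = refl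
∑-append (suc m) n f = trans (cong (f 0 +_) (∑-append m n _)) (sym (+-assoc (f 0) _ _))

∑-truncate : ∀ {m n} f → m ≤ n → (∀ i → m ≤ i → f i ≡ 0) → ∑ n f ≡ ∑ m f
∑-truncate {m} {n} f m≤n vanish = begin
  ∑ n f                              ≡⟨ cong (λ k → ∑ k f) (m+[n∸m]≡n m≤n) ⟨
  ∑ (m + (n ∸ m)) f                  ≡⟨ ∑-append m (n ∸ m) f ⟩
  ∑ m f + ∑ (n ∸ m) (λ i → f (m + i)) ≡⟨ cong (∑ m f +_) (trans (∑-cong (n ∸ m) (λ i _ → vanish (m + i) (m≤m+n m i))) (∑-zero (n ∸ m))) ⟩
  ∑ m f + 0                          ≡⟨ +-identityʳ _ ⟩
  ∑ m f                              ∎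
  where open ≡-Reasoning

∑-digits : ∀ p N f → ∑ (N * p) f ≡ ∑ p (λ a → ∑ N (λ n → f (a + n * p)))
∑-digits p zero    f = sym (∑-zero p)
∑-digits p (suc N) f = begin
  ∑ (p + N * p) f
    ≡⟨ ∑-append p (N * p) f ⟩
  ∑ p f + ∑ (N * p) (λ i → f (p + i))
    ≡⟨ cong (∑ p f +_) (∑-digits p N _) ⟩
  ∑ p f + ∑ p (λ a → ∑ N (λ n → f (p + (a + n * p))))
    ≡⟨ ∑-+ p _ _ ⟨
  ∑ p (λ a → f a + ∑ N (λ n → f (p + (a + n * p))))
    ≡⟨ ∑-cong p (λ a _ → cong₂ _+_ (cong f (sym (+-identityʳ a)))
         (∑-cong N (λ n _ → cong f (ring p a (n * p))))) ⟩
  ∑ p (λ a → f (a + 0) + ∑ N (λ n → f (a + (p + n * p)))) ∎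
  where
  open ≡-Reasoning
  ring : ∀ p a b → p + (a + b) ≡ a + (p + b)
  ring = solve-∀

box∑ : ∀ d → ℕ → (Vec ℕ d → ℕ) → ℕ
box∑ zero    N φ = φ []
box∑ (suc d) N φ = ∑ N (λ i → box∑ d N (λ x → φ (i ∷ x)))

box∑-cong : ∀ d N {φ ψ : Vec ℕ d → ℕ} → (∀ x → All (_< N) x → φ x ≡ ψ x) → box∑ d N φ ≡ box∑ d N ψ
box∑-cong zero    N eq = eq [] []
box∑-cong (suc d) N eq = ∑-cong N (λ i i<N → box∑-cong d N (λ x x<N → eq (i ∷ x) (i<N ∷ x<N)))

box∑-≅ : ∀ {m} d N {φ ψ : Vec ℕ d → ℕ} → (∀ x → All (_< N) x → φ x ≅ ψ x [ m ]) →
         box∑ d N φ ≅ box∑ d N ψ [ m ]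
box∑-≅ zero    N eq = eq [] []
box∑-≅ (suc d) N eq = ∑-≅ N (λ i i<N → box∑-≅ d N (λ x x<N → eq (i ∷ x) (i<N ∷ x<N)))

box∑-zero : ∀ d N → box∑ d N (λ _ → 0) ≡ 0
box∑-zero zero    N = refl
box∑-zero (suc d) N = trans (∑-cong N (λ _ _ → box∑-zero d N)) (∑-zero N)

box∑-+ : ∀ d N φ ψ → box∑ d N (λ x → φ x + ψ x) ≡ box∑ d N φ + box∑ d N ψ
box∑-+ zero    N φ ψ = refl
box∑-+ (suc d) N φ ψ = trans (∑-cong N (λ i _ → box∑-+ d N _ _)) (∑-+ N _ _)

box∑-*ˡ : ∀ d N c φ → box∑ d N (λ x → c * φ x) ≡ c * box∑ d N φ
box∑-*ˡ zero    N c φ = refl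
box∑-*ˡ (suc d) N c φ = trans (∑-cong N (λ i _ → box∑-*ˡ d N c _)) (∑-*ˡ N c _)

box∑-swap : ∀ d N M (ψ : ℕ → Vec ℕ d → ℕ) →
            ∑ M (λ i → box∑ d N (ψ i)) ≡ box∑ d N (λ x → ∑ M (λ i → ψ i x))
box∑-swap d N zero    ψ = sym (box∑-zero d N)
box∑-swap d N (suc M) ψ =
  trans (cong (box∑ d N (ψ 0) +_) (box∑-swap d N M _)) (sym (box∑-+ d N _ _))

infixl 6 _⊕_
infixl 7 _⊛_

_⊕_ : ∀ {d} → Vec ℕ d → Vec ℕ d → Vec ℕ d
_⊕_ = Vec.zipWith _+_

_⊛_ : ∀ {d} → Vec ℕ d → ℕ → Vec ℕ d
x ⊛ c = Vec.map (_* c) x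

box∑-digits : ∀ d p N φ → box∑ d (N * p) φ ≡ box∑ d p (λ a → box∑ d N (λ n → φ (a ⊕ n ⊛ p)))
box∑-digits zero    p N φ = refl
box∑-digits (suc d) p N φ = begin
  ∑ (N * p) (λ i → box∑ d (N * p) (λ x → φ (i ∷ x)))
    ≡⟨ ∑-digits p N _ ⟩
  ∑ p (λ a → ∑ N (λ n → box∑ d (N * p) (λ x → φ (a + n * p ∷ x))))
    ≡⟨ ∑-cong p (λ a _ → ∑-cong N (λ n _ → box∑-digits d p N _)) ⟩
  ∑ p (λ a → ∑ N (λ n → box∑ d p (λ b → box∑ d N (λ m → φ (a + n * p ∷ b ⊕ m ⊛ p)))))
    ≡⟨ ∑-cong p (λ a _ → box∑-swap d p N _) ⟩
  ∑ p (λ a → box∑ d p (λ b → ∑ N (λ n → box∑ d N (λ m → φ (a + n * p ∷ b ⊕ m ⊛ p))))) ∎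
  where open ≡-Reasoning

δ : ℕ → ℕ → ℕ
δ zero    zero    = 1
δ zero    (suc n) = 0
δ (suc m) zero    = 0
δ (suc m) (suc n) = δ m n

δ-refl : ∀ n → δ n n ≡ 1
δ-refl zero    = refl
δ-refl (suc n) = δ-refl n

δ-≢ : ∀ {m n} → m ≢ n → δ m n ≡ 0
δ-≢ {zero}  {zero}  m≢n = ⊥-elim (m≢n refl)
δ-≢ {zero}  {suc n} m≢n = refl
δ-≢ {suc m} {zero}  m≢n = refl
δ-≢ {suc m} {suc n} m≢n = δ-≢ (m≢n ∘ cong suc)

δ-cancelˡ : ∀ k m n → δ (k + m) (k + n) ≡ δ m n
δ-cancelˡ zero    m n = refl
δ-cancelˡ (suc k) m n = δ-cancelˡ k m n

list∑ : ∀ {A : Set} → (A → ℕ) → List A → ℕ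
list∑ φ []       = 0
list∑ φ (x ∷ xs) = φ x + list∑ φ xs

list∑-++ : ∀ {A : Set} (φ : A → ℕ) xs ys → list∑ φ (xs List.++ ys) ≡ list∑ φ xs + list∑ φ ys
list∑-++ φ []       ys = refl
list∑-++ φ (x ∷ xs) ys = trans (cong (φ x +_) (list∑-++ φ xs ys)) (sym (+-assoc (φ x) _ _))

list∑-map : ∀ {A B : Set} (φ : B → ℕ) (h : A → B) xs → list∑ φ (List.map h xs) ≡ list∑ (φ ∘ h) xs
list∑-map φ h []       = refl
list∑-map φ h (x ∷ xs) = cong (φ (h x) +_) (list∑-map φ h xs)

list∑-concatMap-applyUpTo : ∀ {A : Set} (φ : A → ℕ) (F : ℕ → List A) (h : ℕ → ℕ) n →
  list∑ φ (List.concatMap F (List.applyUpTo h n)) ≡ ∑ n (λ i → list∑ φ (F (h i)))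
list∑-concatMap-applyUpTo φ F h zero    = refl
list∑-concatMap-applyUpTo φ F h (suc n) = trans (list∑-++ φ (F (h 0)) _)
  (cong (list∑ φ (F (h 0)) +_) (list∑-concatMap-applyUpTo φ F (h ∘ suc) n))

-- A box, unlike the set of compositions, is a product and splits into digits coordinate by
-- coordinate; the delta factor retains the condition on the sum. Any `N` above `m` serves, so sums
-- of different sizes can share one box.
list∑-compositions : ∀ d {m N} (φ : Vec ℕ d → ℕ) → m < N →
  list∑ φ (compositions d m) ≡ box∑ d N (λ x → δ ∣ x ∣ᵥ m * φ x)
list∑-compositions zero {zero}  φ _ = refl
list∑-compositions zero {suc m} φ _ = refl
list∑-compositions (suc d) {m} {N} φ m<N = begin
  list∑ φ (compositions (suc d) m)
    ≡⟨ list∑-concatMap-applyUpTo φ (λ i → List.map (i ∷_) (compositions d (m ∸ i))) (λ i → i) (suc m) ⟩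
  ∑ (suc m) (λ i → list∑ φ (List.map (i ∷_) (compositions d (m ∸ i))))
    ≡⟨ ∑-cong (suc m) summand ⟩
  ∑ (suc m) (λ i → box∑ d N (λ x → δ (i + ∣ x ∣ᵥ) m * φ (i ∷ x)))
    ≡⟨ ∑-truncate _ m<N vanish ⟨
  ∑ N (λ i → box∑ d N (λ x → δ (i + ∣ x ∣ᵥ) m * φ (i ∷ x))) ∎
  where
  open ≡-Reasoning
  summand : ∀ i → i < suc m → list∑ φ (List.map (i ∷_) (compositions d (m ∸ i))) ≡
                              box∑ d N (λ x → δ (i + ∣ x ∣ᵥ) m * φ (i ∷ x))
  summand i (s≤s i≤m) = begin
    list∑ φ (List.map (i ∷_) (compositions d (m ∸ i)))
      ≡⟨ list∑-map φ (i ∷_) (compositions d (m ∸ i)) ⟩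
    list∑ (φ ∘ (i ∷_)) (compositions d (m ∸ i))
      ≡⟨ list∑-compositions d (φ ∘ (i ∷_)) (≤-<-trans (m∸n≤m m i) m<N) ⟩
    box∑ d N (λ x → δ ∣ x ∣ᵥ (m ∸ i) * φ (i ∷ x))
      ≡⟨ box∑-cong d N (λ x _ → cong (_* φ (i ∷ x))
           (trans (sym (δ-cancelˡ i ∣ x ∣ᵥ (m ∸ i))) (cong (δ (i + ∣ x ∣ᵥ)) (m+[n∸m]≡n i≤m)))) ⟩
    box∑ d N (λ x → δ (i + ∣ x ∣ᵥ) m * φ (i ∷ x)) ∎
  vanish : ∀ i → m < i → box∑ d N (λ x → δ (i + ∣ x ∣ᵥ) m * φ (i ∷ x)) ≡ 0
  vanish i m<i = trans (box∑-cong d N (λ x _ → cong (_* φ (i ∷ x))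
    (δ-≢ (>⇒≢ (≤-trans m<i (m≤m+n i ∣ x ∣ᵥ)))))) (box∑-zero d N)

-- Vectors of natural numbers

·-⊕ : ∀ {d} (w x y : Vec ℕ d) → w · (x ⊕ y) ≡ w · x + w · y
·-⊕ []      []      []      = refl
·-⊕ (c ∷ w) (a ∷ x) (b ∷ y) = trans (cong (c * (a + b) +_) (·-⊕ w x y)) (ring c a b (w · x) (w · y))
  where
  ring : ∀ c a b s t → c * (a + b) + (s + t) ≡ c * a + s + (c * b + t)
  ring = solve-∀

⊕-· : ∀ {d} (w x y : Vec ℕ d) → (w ⊕ x) · y ≡ w · y + x · y
⊕-· []      []      []      = refl
⊕-· (c ∷ w) (a ∷ x) (b ∷ y) = trans (cong ((c + a) * b +_) (⊕-· w x y)) (ring c a b (w · y) (x · y))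
  where
  ring : ∀ c a b s t → (c + a) * b + (s + t) ≡ c * b + s + (a * b + t)
  ring = solve-∀

·-⊛ : ∀ {d} (w x : Vec ℕ d) c → w · (x ⊛ c) ≡ w · x * c
·-⊛ []      []      c = refl
·-⊛ (b ∷ w) (a ∷ x) c = trans (cong (b * (a * c) +_) (·-⊛ w x c)) (ring a b c (w · x))
  where
  ring : ∀ a b c s → b * (a * c) + s * c ≡ (b * a + s) * c
  ring = solve-∀

0-· : ∀ {d} (x : Vec ℕ d) → Vec.replicate d 0 · x ≡ 0
0-· []      = refl
0-· (_ ∷ x) = 0-· x

∣∣-⊕ : ∀ {d} (x y : Vec ℕ d) → ∣ x ⊕ y ∣ᵥ ≡ ∣ x ∣ᵥ + ∣ y ∣ᵥ
∣∣-⊕ []      []      = refl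
∣∣-⊕ (a ∷ x) (b ∷ y) = trans (cong (a + b +_) (∣∣-⊕ x y)) (ring a b ∣ x ∣ᵥ ∣ y ∣ᵥ)
  where
  ring : ∀ a b s t → a + b + (s + t) ≡ a + s + (b + t)
  ring = solve-∀

∣∣-⊛ : ∀ {d} (x : Vec ℕ d) c → ∣ x ⊛ c ∣ᵥ ≡ ∣ x ∣ᵥ * c
∣∣-⊛ []      c = refl
∣∣-⊛ (a ∷ x) c = trans (cong (a * c +_) (∣∣-⊛ x c)) (sym (*-distribʳ-+ c a ∣ x ∣ᵥ))

⊕-digit-shift : ∀ {d} (a n s : Vec ℕ d) c p →
  a ⊕ (n ⊕ s ⊛ c) ⊛ p ≡ (a ⊕ n ⊛ p) ⊕ s ⊛ (p * c)
⊕-digit-shift []      []      []      c p = refl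
⊕-digit-shift (a ∷ x) (n ∷ y) (s ∷ z) c p = cong₂ _∷_ (ring a n s c p) (⊕-digit-shift x y z c p)
  where
  ring : ∀ a n s c p → a + (n + s * c) * p ≡ (a + n * p) + s * (p * c)
  ring = solve-∀

⊛-assoc : ∀ {d} (s : Vec ℕ d) b c → s ⊛ (b * c) ≡ s ⊛ b ⊛ c
⊛-assoc []      b c = refl
⊛-assoc (a ∷ s) b c = cong₂ _∷_ (sym (*-assoc a b c)) (⊛-assoc s b c)

scaledUnit-zero : ∀ {d} c → scaledUnit {suc d} c Fin.zero ≡ c ∷ Vec.replicate d 0
scaledUnit-zero {d} c = cong (c ∷_) (zeros d)
  where
  zeros : ∀ d → Vec.tabulate {n = d} (λ _ → 0) ≡ Vec.replicate d 0
  zeros zero    = refl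
  zeros (suc d) = cong (0 ∷_) (zeros d)

scaledUnit-suc : ∀ {d} c (k : Fin d) → scaledUnit c (Fin.suc k) ≡ 0 ∷ scaledUnit c k
scaledUnit-suc {d} c k = cong (0 ∷_)
  (trans (sym (tabulate∘lookup rest)) (trans (tabulate-cong pointwise) (tabulate∘lookup (scaledUnit c k))))
  where
  rest = Vec.tail (scaledUnit c (Fin.suc k))
  -- the equations carry i ≟F k in their types, so that it is abstracted there as well
  pointwise : ∀ i → lookup rest i ≡ lookup (scaledUnit c k) i
  pointwise i with i ≟F k
                 | (lookup rest i ≡ _) ∋ lookup∘tabulate _ i
                 | (lookup (scaledUnit c k) i ≡ _) ∋ lookup∘tabulate _ i
  ... | yes _ | eq | eq' = trans eq (sym eq')
  ... | no  _ | eq | eq' = trans eq (sym eq')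

lookup-scaledUnit : ∀ {d} c (k : Fin d) → lookup (scaledUnit c k) k ≡ c
lookup-scaledUnit c Fin.zero    = refl
lookup-scaledUnit c (Fin.suc k) =
  trans (cong (λ w → lookup w (Fin.suc k)) (scaledUnit-suc c k)) (lookup-scaledUnit c k)

𝟏-· : ∀ {d} (k : Fin d) x → (𝟏 k) · x ≡ lookup x k
𝟏-· Fin.zero    (a ∷ x) = trans (cong (_· (a ∷ x)) (scaledUnit-zero 1))
  (trans (cong (1 * a +_) (0-· x)) (ring a))
  where
  ring : ∀ a → 1 * a + 0 ≡ a
  ring = solve-∀
𝟏-· (Fin.suc k) (a ∷ x) = trans (cong (_· (a ∷ x)) (scaledUnit-suc 1 k)) (𝟏-· k x)

sumᵥ : ∀ {A : Set} {u} → (A → ℕ) → Vec A u → ℕ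
sumᵥ ψ []      = 0
sumᵥ ψ (w ∷ E) = ψ w + sumᵥ ψ E

∏ᵥ : ∀ {A : Set} {u} → (A → ℕ) → Vec A u → ℕ
∏ᵥ ψ []      = 1
∏ᵥ ψ (w ∷ E) = ψ w * ∏ᵥ ψ E

lookup≤sumᵥ : ∀ {A : Set} {u} (ψ : A → ℕ) (E : Vec A u) i → ψ (lookup E i) ≤ sumᵥ ψ E
lookup≤sumᵥ ψ (w ∷ E) Fin.zero    = m≤m+n _ _
lookup≤sumᵥ ψ (w ∷ E) (Fin.suc i) = ≤-trans (lookup≤sumᵥ ψ E i) (m≤n+m _ _)

∏ᵥ-cong : ∀ {A : Set} {u} {ψ χ : A → ℕ} (E : Vec A u) → (∀ w → ψ w ≡ χ w) → ∏ᵥ ψ E ≡ ∏ᵥ χ E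
∏ᵥ-cong []      eq = refl
∏ᵥ-cong (w ∷ E) eq = cong₂ _*_ (eq w) (∏ᵥ-cong E eq)

∏ᵥ-≅ : ∀ {A : Set} {u m} {ψ χ : A → ℕ} (E : Vec A u) → (∀ w → ψ w ≅ χ w [ m ]) → ∏ᵥ ψ E ≅ ∏ᵥ χ E [ m ]
∏ᵥ-≅ []      eq = ≅-refl
∏ᵥ-≅ (w ∷ E) eq = ≅-* (eq w) (∏ᵥ-≅ E eq)

∏ᵥ-* : ∀ {A : Set} {u} (ψ χ : A → ℕ) (E : Vec A u) → ∏ᵥ (λ w → ψ w * χ w) E ≡ ∏ᵥ ψ E * ∏ᵥ χ E
∏ᵥ-* ψ χ []      = refl
∏ᵥ-* ψ χ (w ∷ E) = trans (cong (ψ w * χ w *_) (∏ᵥ-* ψ χ E)) (ring (ψ w) (χ w) (∏ᵥ ψ E) (∏ᵥ χ E))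
  where
  ring : ∀ a b c d → a * b * (c * d) ≡ a * c * (b * d)
  ring = solve-∀

∏ᵥ-^ : ∀ {A : Set} {u} c (ψ : A → ℕ) (E : Vec A u) → ∏ᵥ (λ w → c ^ ψ w) E ≡ c ^ sumᵥ ψ E
∏ᵥ-^ c ψ []      = refl
∏ᵥ-^ c ψ (w ∷ E) = trans (cong (c ^ ψ w *_) (∏ᵥ-^ c ψ E)) (sym (^-distribˡ-+-* c (ψ w) (sumᵥ ψ E)))

∏ᵥ-∣ : ∀ {A : Set} {u} {ψ χ : A → ℕ} (E : Vec A u) → (∀ w → ψ w ∣ χ w) → ∏ᵥ ψ E ∣ ∏ᵥ χ E
∏ᵥ-∣ []      ψ∣χ = ∣-refl
∏ᵥ-∣ (w ∷ E) ψ∣χ = *-pres-∣ (ψ∣χ w) (∏ᵥ-∣ E ψ∣χ)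

∏ᵥ-map : ∀ {A B : Set} {u} (ψ : B → ℕ) (h : A → B) (E : Vec A u) → ∏ᵥ ψ (Vec.map h E) ≡ ∏ᵥ (ψ ∘ h) E
∏ᵥ-map ψ h []      = refl
∏ᵥ-map ψ h (w ∷ E) = cong (ψ (h w) *_) (∏ᵥ-map ψ h E)

prodFact-∏ᵥ : ∀ {A : Set} {u} (h : A → ℕ) (E : Vec A u) → prodFact (Vec.map h E) ≡ ∏ᵥ (λ w → h w !) E
prodFact-∏ᵥ h []      = refl
prodFact-∏ᵥ h (w ∷ E) = cong (h w ! *_) (prodFact-∏ᵥ h E)

vsum-· : ∀ {d u} (E : Vec (Vec ℕ d) u) x → vsum E · x ≡ sumᵥ (_· x) E
vsum-· []      x = 0-· x
vsum-· (w ∷ E) x = trans (⊕-· w (vsum E) x) (cong (w · x +_) (vsum-· E x))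

-- Integrality of the factorial ratios

-- The product of `(n_k !) ^ w_k` over the coordinates. It turns sums in `w` into products, so over
-- a tuple it depends only on the vector sum, on which `e` and `f` agree.
factorials^ : ∀ {d} → Vec ℕ d → Vec ℕ d → ℕ
factorials^ []      []      = 1
factorials^ (c ∷ w) (a ∷ n) = (a !) ^ c * factorials^ w n

m!*n!∣[m+n]! : ∀ m n → m ! * n ! ∣ (m + n) !
m!*n!∣[m+n]! m n = subst (λ k → m ! * k ! ∣ (m + n) !) (m+n∸m≡n m n) (k![n∸k]!∣n! (m≤m+n m n))

[a!]^c∣[c*a]! : ∀ c a → (a !) ^ c ∣ (c * a) !
[a!]^c∣[c*a]! zero    a = ∣-refl
[a!]^c∣[c*a]! (suc c) a = ∣-trans (*-monoʳ-∣ (a !) ([a!]^c∣[c*a]! c a)) (m!*n!∣[m+n]! a (c * a))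

factorials^∣ : ∀ {d} (w n : Vec ℕ d) → factorials^ w n ∣ (w · n) !
factorials^∣ []      []      = ∣-refl
factorials^∣ (c ∷ w) (a ∷ n) =
  ∣-trans (*-pres-∣ ([a!]^c∣[c*a]! c a) (factorials^∣ w n)) (m!*n!∣[m+n]! (c * a) (w · n))

factorials^-⊕ : ∀ {d} (w x n : Vec ℕ d) → factorials^ (w ⊕ x) n ≡ factorials^ w n * factorials^ x n
factorials^-⊕ []      []      []      = refl
factorials^-⊕ (b ∷ w) (c ∷ x) (a ∷ n) =
  trans (cong₂ _*_ (^-distribˡ-+-* (a !) b c) (factorials^-⊕ w x n))
    (ring ((a !) ^ b) ((a !) ^ c) (factorials^ w n) (factorials^ x n))
  where
  ring : ∀ a b c d → a * b * (c * d) ≡ a * c * (b * d)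
  ring = solve-∀

factorials^-0 : ∀ {d} (n : Vec ℕ d) → factorials^ (Vec.replicate d 0) n ≡ 1
factorials^-0 []      = refl
factorials^-0 (_ ∷ n) = trans (*-identityˡ _) (factorials^-0 n)

factorials^-vsum : ∀ {d u} (E : Vec (Vec ℕ d) u) n → factorials^ (vsum E) n ≡ ∏ᵥ (λ w → factorials^ w n) E
factorials^-vsum []      n = factorials^-0 n
factorials^-vsum (w ∷ E) n =
  trans (factorials^-⊕ w (vsum E) n) (cong (factorials^ w n *_) (factorials^-vsum E n))

factorials^-𝟏 : ∀ {d} (k : Fin d) n → factorials^ (𝟏 k) n ≡ lookup n k !
factorials^-𝟏 Fin.zero (a ∷ n) = trans (cong (λ w → factorials^ w (a ∷ n)) (scaledUnit-zero 1))
  (trans (cong ((a !) ^ 1 *_) (factorials^-0 n)) (ring (a !)))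
  where
  ring : ∀ t → t * 1 * 1 ≡ t
  ring = solve-∀
factorials^-𝟏 (Fin.suc k) (a ∷ n) = trans (cong (λ w → factorials^ w (a ∷ n)) (scaledUnit-suc 1 k))
  (trans (*-identityˡ _) (factorials^-𝟏 k n))

-- For a unit vector `factorials^` is the factorial itself, so balance rewrites the denominator as
-- the product of `factorials^ w n` over `w` in `e`. Each factor divides `(w · n) !` by the
-- integrality of multinomial coefficients.
QDen∣QNum : ∀ {d u v} (e : Vec (Vec ℕ d) u) (ks : Vec (Fin d) v) → vsum e ≡ vsum (unitTuple ks) →
            ∀ n → QDen (unitTuple ks) n ∣ QNum e n
QDen∣QNum e ks balanced n = subst₂ _∣_ (sym denominator) (sym (prodFact-∏ᵥ (_· n) e))
  (∏ᵥ-∣ e (λ w → factorials^∣ w n))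
  where
  open ≡-Reasoning
  denominator : QDen (unitTuple ks) n ≡ ∏ᵥ (λ w → factorials^ w n) e
  denominator = begin
    QDen (unitTuple ks) n                              ≡⟨ prodFact-∏ᵥ (_· n) (unitTuple ks) ⟩
    ∏ᵥ (λ w → (w · n) !) (Vec.map 𝟏_ ks)               ≡⟨ ∏ᵥ-map _ 𝟏_ ks ⟩
    ∏ᵥ (λ k → ((𝟏 k) · n) !) ks                        ≡⟨ ∏ᵥ-cong ks (λ k → trans (cong _! (𝟏-· k n)) (sym (factorials^-𝟏 k n))) ⟩
    ∏ᵥ (λ k → factorials^ (𝟏 k) n) ks                  ≡⟨ ∏ᵥ-map _ 𝟏_ ks ⟨
    ∏ᵥ (λ w → factorials^ w n) (unitTuple ks)          ≡⟨ factorials^-vsum (unitTuple ks) n ⟨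
    factorials^ (vsum (unitTuple ks)) n                ≡⟨ cong (λ w → factorials^ w n) balanced ⟨
    factorials^ (vsum e) n                             ≡⟨ factorials^-vsum e n ⟩
    ∏ᵥ (λ w → factorials^ w n) e                       ∎

-- The part of a factorial prime to p

-- The product `(m + 1) ... (m + q)`: a quotient of factorials here, and later the square root of a
-- value of `prodSq`.
rise : ℕ → ℕ → ℕ
rise m zero    = 1
rise m (suc q) = (suc q + m) * rise m q

!-rise : ∀ q m → (q + m) ! ≡ m ! * rise m q
!-rise zero    m = sym (*-identityʳ (m !))
!-rise (suc q) m = trans (cong ((suc q + m) *_) (!-rise q m)) (ring (suc q + m) (m !) (rise m q))
  where
  ring : ∀ a b c → a * (b * c) ≡ b * (a * c)
  ring = solve-∀

rise-≅ : ∀ {r m m'} q → m ≅ m' [ r ] → rise m q ≅ rise m' q [ r ]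
rise-≅ zero    _    = ≅-refl
rise-≅ (suc q) m≅m' = ≅-* (≅-+ (≅-refl {a = suc q}) m≅m') (rise-≅ q m≅m')

module PrimePart {p : ℕ} .{{_ : NonZero p}} (pr : Prime p) where

  1<p : 1 < p
  1<p = nonTrivial⇒n>1 p {{prime⇒nonTrivial pr}}

  ∤-* : ∀ {a b} → ¬ p ∣ a → ¬ p ∣ b → ¬ p ∣ a * b
  ∤-* {a} {b} p∤a p∤b p∣ab = Sum.[ p∤a , p∤b ] (euclidsLemma a b pr p∣ab)

  p∤1 : ¬ p ∣ 1
  p∤1 p∣1 = <⇒≢ 1<p (sym (∣1⇒≡1 p∣1))

  ∤-digit : ∀ {r} m → 0 < r → r < p → ¬ p ∣ r + m * p
  ∤-digit {r} m 0<r r<p p∣ = <⇒≱ r<p (∣⇒≤ {{>-nonZero 0<r}}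
    (∣m+n∣m⇒∣n (subst (p ∣_) (+-comm r (m * p)) p∣) (n∣m*n m)))

  unitPart : ℕ → ℕ
  unitPart j with p ∣? j
  ... | yes _ = 1
  ... | no  _ = j

  unitPart-∣ : ∀ {j} → p ∣ j → unitPart j ≡ 1
  unitPart-∣ {j} p∣j with p ∣? j
  ... | yes _   = refl
  ... | no  p∤j = ⊥-elim (p∤j p∣j)

  unitPart-∤ : ∀ {j} → ¬ p ∣ j → unitPart j ≡ j
  unitPart-∤ {j} p∤j with p ∣? j
  ... | yes p∣j = ⊥-elim (p∤j p∣j)
  ... | no  _   = refl

  ∤unitPart : ∀ j → ¬ p ∣ unitPart j
  ∤unitPart j with p ∣? j
  ... | yes _   = p∤1
  ... | no  p∤j = p∤j

  -- The product of the integers up to `x` that are prime to `p`; up to sign, Morita's p-adic gamma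
  -- function at `x + 1`.
  unit! : ℕ → ℕ
  unit! zero    = 1
  unit! (suc x) = unit! x * unitPart (suc x)

  ∤unit! : ∀ x → ¬ p ∣ unit! x
  ∤unit! zero    = p∤1
  ∤unit! (suc x) = ∤-* (∤unit! x) (∤unitPart (suc x))

  unitPart-periodic : ∀ k j → unitPart (j + p ^ suc k) ≅ unitPart j [ p ^ suc k ]
  unitPart-periodic k j with p ∣? j
  ... | yes p∣j = ≅-reflexive (unitPart-∣ (∣m∣n⇒∣m+n p∣j (m∣m*n (p ^ k))))
  ... | no  p∤j = ≅-trans (≅-reflexive (unitPart-∤ (λ p∣ → p∤j (∣m+n∣m⇒∣n (subst (p ∣_) (+-comm j _) p∣) (m∣m*n (p ^ k))))))
    (shifts 0 1 (trans (+-identityʳ _) (cong (j +_) (sym (+-identityʳ _)))))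

  -- Passing to `suc x` multiplies both sides by congruent factors. The constant `unit! (p ^ k)`
  -- stays unevaluated: equal powers of it will stand in numerator and denominator of the factorial
  -- ratio.
  unit!-shift : ∀ k x → unit! (x + p ^ k) ≅ unit! x * unit! (p ^ k) [ p ^ k ]
  unit!-shift zero    x       = ≅-mod1
  unit!-shift (suc k) zero    = ≅-reflexive (sym (*-identityˡ _))
  unit!-shift (suc k) (suc x) = ≅-trans (≅-* (unit!-shift (suc k) x) (unitPart-periodic k (suc x)))
    (≅-reflexive (ring (unit! x) (unit! (p ^ suc k)) (unitPart (suc x))))
    where
    ring : ∀ a b c → a * b * c ≡ a * c * b
    ring = solve-∀

  unit!-shifts : ∀ k x s → unit! (x + s * p ^ k) ≅ unit! x * unit! (p ^ k) ^ s [ p ^ k ]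
  unit!-shifts k x zero    = ≅-reflexive (trans (cong unit! (+-identityʳ x)) (sym (*-identityʳ _)))
  unit!-shifts k x (suc s) = ≅-trans (≅-reflexive (cong unit! (ring₁ x (p ^ k) (s * p ^ k))))
    (≅-trans (unit!-shift k (x + s * p ^ k)) (≅-trans (≅-*ʳ (unit! (p ^ k)) (unit!-shifts k x s))
      (≅-reflexive (ring₂ (unit! x) (unit! (p ^ k) ^ s) (unit! (p ^ k))))))
    where
    ring₁ : ∀ x a b → x + (a + b) ≡ x + b + a
    ring₁ = solve-∀
    ring₂ : ∀ a b c → a * b * c ≡ a * (c * b)
    ring₂ = solve-∀

  -- The multiples of `p` up to `r + m * p` are `1 * p`, ..., `m * p`, with product `p ^ m * m !`;
  -- the remaining factors form `unit!`.
  !-digit : ∀ m r → r < p → (r + m * p) ! ≡ p ^ m * m ! * unit! (r + m * p)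
  !-digit zero    zero    _   = refl
  !-digit (suc m) zero    _   = begin
    (p + m * p) !
      ≡⟨ cong (λ k → (k + m * p) !) (sym suc-p') ⟩
    (suc p' + m * p) * (p' + m * p) !
      ≡⟨ cong₂ _*_ (cong (_+ m * p) suc-p') (!-digit m p' (≤-reflexive suc-p')) ⟩
    (p + m * p) * (p ^ m * m ! * unit! (p' + m * p))
      ≡⟨ ring p m (p ^ m) (m !) (unit! (p' + m * p)) ⟩
    p * p ^ m * (suc m * m !) * (unit! (p' + m * p) * 1)
      ≡⟨ cong (λ t → p * p ^ m * (suc m * m !) * (unit! (p' + m * p) * t)) (sym (unitPart-∣ (subst (λ k → p ∣ k + m * p) (sym suc-p') (∣m∣n⇒∣m+n ∣-refl (n∣m*n m))))) ⟩
    p * p ^ m * (suc m * m !) * unit! (suc p' + m * p)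
      ≡⟨ cong (λ k → p ^ suc m * suc m ! * unit! (k + m * p)) suc-p' ⟩
    p ^ suc m * suc m ! * unit! (p + m * p) ∎
    where
    open ≡-Reasoning
    p' = pred p
    suc-p' : suc p' ≡ p
    suc-p' = suc-pred p
    ring : ∀ p m a b c → (p + m * p) * (a * b * c) ≡ p * a * ((1 + m) * b) * (c * 1)
    ring = solve-∀
  !-digit m (suc r) r<p = begin
    (suc r + m * p) * (r + m * p) !
      ≡⟨ cong ((suc r + m * p) *_) (!-digit m r (<⇒≤ r<p)) ⟩
    (suc r + m * p) * (p ^ m * m ! * unit! (r + m * p))
      ≡⟨ ring (suc r + m * p) (p ^ m * m !) (unit! (r + m * p)) ⟩
    p ^ m * m ! * (unit! (r + m * p) * (suc r + m * p))
      ≡⟨ cong (λ t → p ^ m * m ! * (unit! (r + m * p) * t)) (sym (unitPart-∤ (∤-digit m z<s r<p))) ⟩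
    p ^ m * m ! * unit! (suc r + m * p) ∎
    where
    open ≡-Reasoning
    ring : ∀ a b c → a * (b * c) ≡ b * (c * a)
    ring = solve-∀

  -- The product of `p (m + 1)`, ..., `p (m + q)`. For `q = b / p` these are the multiples of `p` in
  -- `(b + m * p) !` beyond `m * p`.
  carryFactor : ℕ → ℕ → ℕ
  carryFactor m q = p ^ q * rise m q

  !-digits : ∀ b m → (b + m * p) ! ≡ p ^ m * (m ! * (carryFactor m (b /ℕ p) * unit! (b + m * p)))
  !-digits b m = begin
    (b + m * p) !
      ≡⟨ cong _! split ⟩
    (r + (q + m) * p) !
      ≡⟨ !-digit (q + m) r (m%n<n b p) ⟩
    p ^ (q + m) * (q + m) ! * unit! (r + (q + m) * p)
      ≡⟨ cong₂ _*_ (cong₂ _*_ (^-distribˡ-+-* p q m) (!-rise q m)) (cong unit! (sym split)) ⟩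
    p ^ q * p ^ m * (m ! * rise m q) * unit! (b + m * p)
      ≡⟨ ring (p ^ q) (p ^ m) (m !) (rise m q) (unit! (b + m * p)) ⟩
    p ^ m * (m ! * (carryFactor m q * unit! (b + m * p))) ∎
    where
    open ≡-Reasoning
    q = b /ℕ p
    r = b % p
    ring₁ : ∀ r q m p → (r + q * p) + m * p ≡ r + (q + m) * p
    ring₁ = solve-∀
    split : b + m * p ≡ r + (q + m) * p
    split = trans (cong (_+ m * p) (m≡m%n+[m/n]*n b p)) (ring₁ r q m p)
    ring : ∀ a b c d e → a * b * (c * d) * e ≡ b * (c * (a * d * e))
    ring = solve-∀

  -- Each factor `p (m + i)` is `p` times a Lipschitz function of `m`, hence the gain of one level;
  -- with `q` zero the value is constant.
  carryFactor-shift : ∀ k {m m'} q → m ≅ m' [ p ^ k ] → carryFactor m q ≅ carryFactor m' q [ p ^ suc k ]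
  carryFactor-shift k zero    _ = ≅-refl
  carryFactor-shift k {m} {m'} (suc q) m≅m' =
    ≅-trans (≅-reflexive (ring p (p ^ q) (suc q + m) (rise m q)))
      (≅-trans (≅-* (≅-scale p (≅-+ (≅-refl {a = suc q}) m≅m')) (carryFactor-shift k q m≅m'))
        (≅-reflexive (sym (ring p (p ^ q) (suc q + m') (rise m' q)))))
    where
    ring : ∀ p a b c → p * a * (b * c) ≡ p * b * (a * c)
    ring = solve-∀

  module _ {d u : ℕ} (E : Vec (Vec ℕ d) u) where

    unit!∏ : Vec ℕ d → ℕ
    unit!∏ x = ∏ᵥ (λ w → unit! (w · x)) E

    carry : Vec ℕ d → ℕ
    carry a = sumᵥ (λ w → w · a /ℕ p) E

    carryFactor∏ : Vec ℕ d → Vec ℕ d → ℕ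
    carryFactor∏ a n = ∏ᵥ (λ w → carryFactor (w · n) (w · a /ℕ p)) E

    rise∏ : Vec ℕ d → Vec ℕ d → ℕ
    rise∏ a n = ∏ᵥ (λ w → rise (w · n) (w · a /ℕ p)) E

    carryFactor∏≡ : ∀ a n → carryFactor∏ a n ≡ p ^ carry a * rise∏ a n
    carryFactor∏≡ a n = trans (∏ᵥ-* _ _ E) (cong (_* rise∏ a n) (∏ᵥ-^ p _ E))

    ·-shift-≅ : ∀ k w (n s : Vec ℕ d) → w · (n ⊕ s ⊛ p ^ k) ≅ w · n [ p ^ k ]
    ·-shift-≅ k w n s = shifts 0 (w · s) (trans (+-identityʳ _)
      (trans (·-⊕ w n (s ⊛ p ^ k)) (cong (w · n +_) (·-⊛ w s (p ^ k)))))

    carryFactor∏-shift : ∀ k a n s → carryFactor∏ a (n ⊕ s ⊛ p ^ k) ≅ carryFactor∏ a n [ p ^ suc k ]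
    carryFactor∏-shift k a n s = ∏ᵥ-≅ E (λ w → carryFactor-shift k (w · a /ℕ p) (·-shift-≅ k w n s))

    rise∏-shift : ∀ k a n s → rise∏ a (n ⊕ s ⊛ p ^ k) ≅ rise∏ a n [ p ^ k ]
    rise∏-shift k a n s = ∏ᵥ-≅ E (λ w → rise-≅ (w · a /ℕ p) (·-shift-≅ k w n s))

    ∤unit!∏ : ∀ x → ¬ p ∣ unit!∏ x
    ∤unit!∏ x = go E
      where
      go : ∀ {u} (E : Vec (Vec ℕ d) u) → ¬ p ∣ ∏ᵥ (λ w → unit! (w · x)) E
      go []      = p∤1
      go (w ∷ E) = ∤-* (∤unit! (w · x)) (go E)

    unit!∏-shift : ∀ k x s → unit!∏ (x ⊕ s ⊛ p ^ k) ≅ unit!∏ x * unit! (p ^ k) ^ (vsum E · s) [ p ^ k ]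
    unit!∏-shift k x s = ≅-trans
      (∏ᵥ-≅ E (λ w → ≅-trans
        (≅-reflexive (cong unit! (trans (·-⊕ w x (s ⊛ p ^ k)) (cong (w · x +_) (·-⊛ w s (p ^ k))))))
        (unit!-shifts k (w · x) (w · s))))
      (≅-reflexive (trans (∏ᵥ-* _ _ E) (cong (unit!∏ x *_)
        (trans (∏ᵥ-^ (unit! (p ^ k)) _ E) (cong (unit! (p ^ k) ^_) (sym (vsum-· E s)))))))

    factorials-digits : ∀ a n → prodFact (Vec.map (_· (a ⊕ n ⊛ p)) E) ≡
      p ^ (vsum E · n) * (prodFact (Vec.map (_· n) E) * (carryFactor∏ a n * unit!∏ (a ⊕ n ⊛ p)))
    factorials-digits a n = begin
      prodFact (Vec.map (_· x) E)
        ≡⟨ prodFact-∏ᵥ (_· x) E ⟩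
      ∏ᵥ (λ w → (w · x) !) E
        ≡⟨ ∏ᵥ-cong E (λ w → trans (cong _! (dot w)) (trans (!-digits (w · a) (w · n))
             (cong (λ t → p ^ (w · n) * ((w · n) ! * (carryFactor (w · n) (w · a /ℕ p) * unit! t))) (sym (dot w))))) ⟩
      ∏ᵥ (λ w → p ^ (w · n) * ((w · n) ! * (carryFactor (w · n) (w · a /ℕ p) * unit! (w · x)))) E
        ≡⟨ trans (∏ᵥ-* _ _ E) (cong₂ _*_ (trans (∏ᵥ-^ p _ E) (cong (p ^_) (sym (vsum-· E n))))
             (trans (∏ᵥ-* _ _ E) (cong₂ _*_ (sym (prodFact-∏ᵥ (_· n) E)) (∏ᵥ-* _ _ E)))) ⟩
      p ^ (vsum E · n) * (prodFact (Vec.map (_· n) E) * (carryFactor∏ a n * unit!∏ x)) ∎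
      where
      open ≡-Reasoning
      x = a ⊕ n ⊛ p
      dot : ∀ w → w · x ≡ w · a + w · n * p
      dot w = trans (·-⊕ w a (n ⊛ p)) (cong (w · a +_) (·-⊛ w n p))

  -- The shape of `f` enters here: `(𝟏 k) · a` is a single digit of `a`, below `p`, so the
  -- denominator produces no carry.
  carryFactor∏-unit : ∀ {d v} (ks : Vec (Fin d) v) a n → All (_< p) a → carryFactor∏ (unitTuple ks) a n ≡ 1
  carryFactor∏-unit []       a n a<p = refl
  carryFactor∏-unit (k ∷ ks) a n a<p = cong₂ _*_
    (cong (carryFactor ((𝟏 k) · n)) (m<n⇒m/n≡0 (subst (_< p) (sym (𝟏-· k a)) (lookup⁺ a<p k))))
    (carryFactor∏-unit ks a n a<p)

  -- the 1-Lipschitz condition of the p-adic metric, tested on residues modulo p ^ j only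
  Lipschitz : ∀ {d} → ℕ → (Vec ℕ d → ℕ) → Set
  Lipschitz j g = ∀ k → k ≤ j → ∀ x s → g (x ⊕ s ⊛ p ^ k) ≅ g x [ p ^ k ]

  Lipschitz-* : ∀ {d j} {g h : Vec ℕ d → ℕ} → Lipschitz j g → Lipschitz j h → Lipschitz j (λ x → g x * h x)
  Lipschitz-* lg lh k k≤j x s = ≅-* (lg k k≤j x s) (lh k k≤j x s)

  module FactorialRatio {d u v} (e : Vec (Vec ℕ d) u) (ks : Vec (Fin d) v)
                        (balanced : vsum e ≡ vsum (unitTuple ks)) where

    private f = unitTuple ks

    abstract
      Q : Vec ℕ d → ℕ
      Q n = quotient (QDen∣QNum e ks balanced n)

      QNum≡ : ∀ n → QNum e n ≡ QDen f n * Q n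
      QNum≡ n = trans (_∣_.equality (QDen∣QNum e ks balanced n)) (*-comm (Q n) (QDen f n))

    -- The digit formulas for numerator and denominator are divided by each other; their powers of
    -- `p` cancel by balance. The identity stays cross-multiplied because `unit!∏ f` is invertible
    -- only modulo powers of `p`.
    Q-digits : ∀ a n → All (_< p) a → unit!∏ f (a ⊕ n ⊛ p) * Q (a ⊕ n ⊛ p) ≡
                                       Q n * (carryFactor∏ e a n * unit!∏ e (a ⊕ n ⊛ p))
    Q-digits a n a<p = *-cancelˡ-≡ _ _ (p ^ (vsum e · n) * QDen f n)
      {{m*n≢0 _ _ {{m^n≢0 p (vsum e · n)}} {{QDen≢0 f n}}}} (begin
        A * D * (unit!∏ f x * Q x)
          ≡⟨ ring₁ A D (unit!∏ f x) (Q x) ⟩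
        A * (D * (1 * unit!∏ f x)) * Q x
          ≡⟨ cong (_* Q x) (sym denominator) ⟩
        QDen f x * Q x
          ≡⟨ sym (QNum≡ x) ⟩
        QNum e x
          ≡⟨ factorials-digits e a n ⟩
        A * (QNum e n * (carryFactor∏ e a n * unit!∏ e x))
          ≡⟨ cong (λ t → A * (t * (carryFactor∏ e a n * unit!∏ e x))) (QNum≡ n) ⟩
        A * (D * Q n * (carryFactor∏ e a n * unit!∏ e x))
          ≡⟨ ring₂ A D (Q n) (carryFactor∏ e a n * unit!∏ e x) ⟩
        A * D * (Q n * (carryFactor∏ e a n * unit!∏ e x)) ∎)
      where
      open ≡-Reasoning
      x = a ⊕ n ⊛ p
      A = p ^ (vsum e · n)
      D = QDen f n
      denominator : QDen f x ≡ A * (D * (1 * unit!∏ f x))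
      denominator = trans (factorials-digits f a n)
        (cong₂ (λ s t → p ^ (s · n) * (D * (t * unit!∏ f x))) (sym balanced) (carryFactor∏-unit ks a n a<p))
      ring₁ : ∀ a d z q → a * d * (z * q) ≡ a * (d * (1 * z)) * q
      ring₁ = solve-∀
      ring₂ : ∀ a d q b → a * (d * q * b) ≡ a * d * (q * b)
      ring₂ = solve-∀

    -- A residue modulo `p ^ j` of the p-adic unit `unit!∏ e x / unit!∏ f x`.
    unitRatio : ℕ → Vec ℕ d → ℕ
    unitRatio j x = unit!∏ e x * proj₁ (inverse pr (∤unit!∏ f x) j)

    unitRatio-* : ∀ j x → unit!∏ f x * unitRatio j x ≅ unit!∏ e x [ p ^ j ]
    unitRatio-* j x = ≅-trans (≅-reflexive (ring (unit!∏ f x) (unit!∏ e x) _))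
      (≅-trans (≅-*ˡ (unit!∏ e x) (proj₂ (inverse pr (∤unit!∏ f x) j))) (≅-reflexive (*-identityʳ _)))
      where
      ring : ∀ a b c → a * (b * c) ≡ b * (a * c)
      ring = solve-∀

    -- A shift multiplies `unit!∏` by a power of `unit! (p ^ k)` whose exponent depends only on the
    -- vector sum of the tuple; by balance the same power appears for `e` and `f`.
    unitRatio-Lipschitz : ∀ j → Lipschitz j (unitRatio j)
    unitRatio-Lipschitz j k k≤j x s = ≅-cancel-unit (unit!∏ f x') (proj₂ (inverse pr (∤unit!∏ f x') k)) (
      ≅-trans (lower (unitRatio-* j x')) (≅-trans (unit!∏-shift e k x s) (≅-sym
        (≅-trans (≅-*ʳ (unitRatio j x) (unit!∏-shift f k x s))
          (≅-trans (≅-reflexive (ring (unit!∏ f x) (unit! (p ^ k) ^ (vsum f · s)) (unitRatio j x)))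
            (≅-* (lower (unitRatio-* j x))
              (≅-reflexive (cong (λ t → unit! (p ^ k) ^ (t · s)) (sym balanced)))))))))
      where
      x' = x ⊕ s ⊛ p ^ k
      lower : ∀ {a b} → a ≅ b [ p ^ j ] → a ≅ b [ p ^ k ]
      lower = ≅-weaken (^-∣ p k≤j)
      ring : ∀ a b c → a * b * c ≡ a * c * b
      ring = solve-∀

    Q-digits-≅ : ∀ j a n → All (_< p) a →
      Q (a ⊕ n ⊛ p) ≅ Q n * (carryFactor∏ e a n * unitRatio j (a ⊕ n ⊛ p)) [ p ^ j ]
    Q-digits-≅ j a n a<p = ≅-cancel-unit (unit!∏ f x) (proj₂ (inverse pr (∤unit!∏ f x) j)) (
      ≅-trans (≅-reflexive (Q-digits a n a<p)) (
        ≅-trans (≅-*ˡ (Q n) (≅-*ˡ (carryFactor∏ e a n) (≅-sym (unitRatio-* j x))))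
          (≅-reflexive (ring (Q n) (carryFactor∏ e a n) (unit!∏ f x) (unitRatio j x)))))
      where
      x = a ⊕ n ⊛ p
      ring : ∀ a b c d → a * (b * (c * d)) ≡ c * (a * (b * d))
      ring = solve-∀

-- Admissibility

weight≤· : ∀ {d} (w a : Vec ℕ d) → w ≥ᵥ 𝟏ᵥ → ∣ a ∣ᵥ ≤ w · a
weight≤· []      []      w≥1 = z≤n
weight≤· (c ∷ w) (x ∷ a) w≥1 = +-mono-≤ (≤-trans (≤-reflexive (sym (*-identityˡ x))) (*-monoˡ-≤ x (w≥1 Fin.zero)))
  (weight≤· w a (λ i → w≥1 (Fin.suc i)))

lookup*lookup≤· : ∀ {d} (w a : Vec ℕ d) k → lookup w k * lookup a k ≤ w · a
lookup*lookup≤· (c ∷ w) (x ∷ a) Fin.zero    = m≤m+n _ _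
lookup*lookup≤· (c ∷ w) (x ∷ a) (Fin.suc k) = ≤-trans (lookup*lookup≤· w a k) (m≤n+m _ _)

maximalEntry : ∀ {d} (a : Vec ℕ (suc d)) → Σ (Fin (suc d)) λ k → ∣ a ∣ᵥ ≤ suc d * lookup a k
maximalEntry (x ∷ [])       = Fin.zero , ≤-refl
maximalEntry {suc d} (x ∷ a@(_ ∷ _)) with maximalEntry a
... | k , ∣a∣≤ with ≤-total x (lookup a k)
...   | inj₁ x≤ = Fin.suc k , +-mono-≤ x≤ ∣a∣≤
...   | inj₂ ≤x = Fin.zero , +-monoʳ-≤ x (≤-trans ∣a∣≤ (*-monoʳ-≤ (suc d) ≤x))

Dominating : ∀ {d u} → Vec (Vec ℕ d) u → Set
Dominating {d} {u} e = ∀ a → Σ (Fin u) λ i → ∣ a ∣ᵥ ≤ lookup e i · a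

-- If s is positive, one vector above `𝟏ᵥ` serves every `a`. If s = 0, the choice depends on `a`:
-- for its largest entry `lookup a k`, a vector whose k-th entry is at least d works, since d times
-- the maximum bounds the sum.
admissible⇒dominating : ∀ {d u} (e : Vec (Vec ℕ d) u) → 1 ≤ d → Admissible 2 e → Dominating e
admissible⇒dominating {suc d} e _ (suc s , _ , inj₂ (i ∷ _ , _ , e≥1) , _) a = i , weight≤· (lookup e i) a (e≥1 Fin.zero)
admissible⇒dominating {suc d} e _ (zero , _ , _ , inj₂ indices) a with maximalEntry a
... | k , ∣a∣≤ with indices k
...   | i ∷ _ , _ , e≥ = i , ≤-trans ∣a∣≤ (≤-trans
        (*-monoˡ-≤ (lookup a k) (subst (_≤ lookup (lookup e i) k) (lookup-scaledUnit (suc d) k) (e≥ Fin.zero k)))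
        (lookup*lookup≤· (lookup e i) a k))

-- Counting base-p digits in a set that omits 0

module DigitCount {p : ℕ} .{{_ : NonZero p}} (1<p : 1 < p)
                  (z : ℕ → ℕ) (z≤1 : ∀ v → z v ≤ 1) (z0 : z 0 ≡ 0) where

  -- The fuel mirrors `digitsAux`; an excess of it is harmless because leading zeros are not
  -- counted.
  αFuel : ℕ → ℕ → ℕ
  αFuel zero    n = 0
  αFuel (suc f) n = z (n % p) + αFuel f (n /ℕ p)

  α : ℕ → ℕ
  α n = αFuel n n

  private
    z[0%p]≡0 : z (0 % p) ≡ 0
    z[0%p]≡0 = trans (cong z (m<n⇒m%n≡m (<-trans z<s 1<p))) z0

  αFuel-0 : ∀ f → αFuel f 0 ≡ 0
  αFuel-0 zero    = refl
  αFuel-0 (suc f) = cong₂ _+_ z[0%p]≡0 (trans (cong (αFuel f) (0/n≡0 p)) (αFuel-0 f))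

  αFuel-irrelevant : ∀ f f' n → n ≤ f → n ≤ f' → αFuel f n ≡ αFuel f' n
  αFuel-irrelevant f f' zero _ _ = trans (αFuel-0 f) (sym (αFuel-0 f'))
  αFuel-irrelevant (suc f) (suc f') (suc n) (s≤s n≤f) (s≤s n≤f') =
    cong (z (suc n % p) +_) (αFuel-irrelevant f f' (suc n /ℕ p) (≤-trans smaller n≤f) (≤-trans smaller n≤f'))
    where
    smaller : suc n /ℕ p ≤ n
    smaller = s≤s⁻¹ (m/n<m (suc n) p 1<p)

  α-unfold : ∀ m → α m ≡ z (m % p) + α (m /ℕ p)
  α-unfold zero    = sym (cong₂ _+_ z[0%p]≡0 (cong α (0/n≡0 p)))
  α-unfold (suc m) = cong (z (suc m % p) +_)
    (αFuel-irrelevant m (suc m /ℕ p) (suc m /ℕ p) (s≤s⁻¹ (m/n<m (suc m) p 1<p)) ≤-refl)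

  digit-% : ∀ {v} n → v < p → (v + n * p) % p ≡ v
  digit-% {v} n v<p = trans ([m+kn]%n≡m%n v n p) (m<n⇒m%n≡m v<p)

  digit-/ : ∀ {v} n → v < p → (v + n * p) /ℕ p ≡ n
  digit-/ {v} n v<p = trans (+-distrib-/-∣ʳ v (n∣m*n n)) (cong₂ _+_ (m<n⇒m/n≡0 v<p) (m*n/n≡m n p))

  α-digit : ∀ {v} n → v < p → α (v + n * p) ≡ z v + α n
  α-digit {v} n v<p = trans (α-unfold (v + n * p))
    (cong₂ (λ r q → z r + α q) (digit-% n v<p) (digit-/ n v<p))

  α-/≤ : ∀ m → α (m /ℕ p) ≤ α m
  α-/≤ m = ≤-trans (m≤n+m _ _) (≤-reflexive (sym (α-unfold m)))

  α≤1+α-/ : ∀ m → α m ≤ suc (α (m /ℕ p))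
  α≤1+α-/ m = ≤-trans (≤-reflexive (α-unfold m)) (+-monoˡ-≤ (α (m /ℕ p)) (z≤1 (m % p)))

  -- Passing from m to suc m turns trailing digits p - 1 into 0, which is not counted.
  α-suc : ∀ m → α (suc m) ≤ suc (α (m /ℕ p))
  α-suc = <-rec _ step
    where
    step : ∀ m → (∀ {i} → i < m → α (suc i) ≤ suc (α (i /ℕ p))) → α (suc m) ≤ suc (α (m /ℕ p))
    step m ih with suc (m % p) <? p
    ... | yes r<p = ≤-trans
      (≤-reflexive (trans (cong (α ∘ suc) (m≡m%n+[m/n]*n m p)) (α-digit (m /ℕ p) r<p)))
      (+-monoˡ-≤ (α (m /ℕ p)) (z≤1 (suc (m % p))))
    ... | no r≮p = ≤-trans (≤-reflexive (trans (cong α suc-m) (trans (α-digit (suc (m /ℕ p)) (<-trans z<s 1<p)) (cong (_+ α (suc (m /ℕ p))) z0))))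
      (≤-trans (ih smaller) (s≤s (α-/≤ (m /ℕ p))))
      where
      r≡ : suc (m % p) ≡ p
      r≡ = ≤-antisym (m%n<n m p) (≮⇒≥ r≮p)
      suc-m : suc m ≡ 0 + suc (m /ℕ p) * p
      suc-m = trans (cong suc (m≡m%n+[m/n]*n m p)) (cong (_+ m /ℕ p * p) r≡)
      smaller : m /ℕ p < m
      smaller = m/n<m m p {{>-nonZero 0<m}} 1<p
        where
        0<m : 0 < m
        0<m = ≤-trans (s≤s⁻¹ (≤-trans 1<p (≤-reflexive (sym r≡)))) (m%n≤m m p)

  -- The first unit step drops the last digit of `m` for free, by `α-suc`; every further step costs
  -- at most one. Having `m /ℕ p` on the right lets the weaker exponent of the weighted claim
  -- suffice whenever a carry occurs.
  α-+ : ∀ m t → 1 ≤ t → α (m + t) ≤ t + α (m /ℕ p)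
  α-+ m (suc zero)    _ = subst (λ k → α k ≤ 1 + α (m /ℕ p)) (+-comm 1 m) (α-suc m)
  α-+ m (suc (suc t)) _ = ≤-trans (≤-reflexive (cong α (+-suc m (suc t)))) (≤-trans (α-suc (m + suc t))
    (s≤s (≤-trans (α-/≤ (m + suc t)) (α-+ m (suc t) (s≤s z≤n)))))

-- Weighted sums and their divisibility

module WeightedSums {p : ℕ} .{{_ : NonZero p}} (pr : Prime p) {d u v : ℕ}
                    (e : Vec (Vec ℕ d) u) (ks : Vec (Fin d) v)
                    (balanced : vsum e ≡ vsum (unitTuple ks)) (dominating : Dominating e) where

  open PrimePart {p} pr
  open FactorialRatio e ks balanced public

  𝕊 : (Vec ℕ d → ℕ) → ℕ → ℕ
  𝕊 g m = list∑ (λ x → Q x * g x) (compositions d m)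

  S : ℕ → ℕ
  S m = list∑ Q (compositions d m)

  𝕊-box : ∀ {m N} g → m < N → 𝕊 g m ≡ box∑ d N (λ x → δ ∣ x ∣ᵥ m * (Q x * g x))
  𝕊-box g = list∑-compositions d (λ x → Q x * g x)

  𝕊-affine : ∀ {g h : Vec ℕ d → ℕ} a b m → (∀ x → g x ≡ a + b * h x) → 𝕊 g m ≡ a * S m + b * 𝕊 h m
  𝕊-affine {g} {h} a b m eq = go (compositions d m)
    where
    ring : ∀ a b q h s t → q * (a + b * h) + (a * s + b * t) ≡ a * (q + s) + b * (q * h + t)
    ring = solve-∀
    ring₀ : ∀ a b → 0 ≡ a * 0 + b * 0
    ring₀ = solve-∀
    go : ∀ xs → list∑ (λ x → Q x * g x) xs ≡ a * list∑ Q xs + b * list∑ (λ x → Q x * h x) xs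
    go []       = ring₀ a b
    go (x ∷ xs) = trans (cong₂ _+_ (cong (Q x *_) (eq x)) (go xs)) (ring a b (Q x) (h x) _ _)

  𝕊-1 : ∀ m → 𝕊 (λ _ → 1) m ≡ S m
  𝕊-1 m = trans (𝕊-affine {h = λ _ → 0} 1 0 m (λ _ → refl)) (ring (S m))
    where
    ring : ∀ s → 1 * s + 0 ≡ s
    ring = solve-∀

  private
    0ᵥ : ∀ {d} → Vec ℕ d
    0ᵥ = Vec.replicate _ 0

    ·-0 : ∀ {d} (w : Vec ℕ d) → w · 0ᵥ ≡ 0
    ·-0 []      = refl
    ·-0 (c ∷ w) = trans (cong (_+ w · 0ᵥ) (*-zeroʳ c)) (·-0 w)

    QNum-0 : ∀ {u} (E : Vec (Vec ℕ d) u) → QNum E 0ᵥ ≡ 1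
    QNum-0 []      = refl
    QNum-0 (w ∷ E) = cong₂ (λ s t → s ! * t) (·-0 w) (QNum-0 E)

    compositions-0 : ∀ d → compositions d 0 ≡ 0ᵥ ∷ []
    compositions-0 zero    = refl
    compositions-0 (suc d) = cong (λ xs → List.map (0 ∷_) xs List.++ []) (compositions-0 d)

    0⊕ : ∀ {d} (n : Vec ℕ d) → 0ᵥ ⊕ n ⊛ 1 ≡ n
    0⊕ []      = refl
    0⊕ (a ∷ n) = cong₂ _∷_ (*-identityʳ a) (0⊕ n)

  S-0 : S 0 ≡ 1
  S-0 = trans (cong (list∑ Q) (compositions-0 d)) (trans (+-identityʳ (Q 0ᵥ))
    (m*n≡1⇒n≡1 (QDen (unitTuple ks) 0ᵥ) (Q 0ᵥ) (trans (sym (QNum≡ 0ᵥ)) (QNum-0 e))))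

  δ-digits : ∀ {r s} y n → r ≡ s → δ (r + y * p) (s + n * p) ≡ δ y n
  δ-digits {r} y n refl with y ≟ n
  ... | yes refl = trans (δ-refl (r + y * p)) (sym (δ-refl y))
  ... | no  y≢n  = trans (δ-≢ (λ eq → y≢n (*-cancelʳ-≡ y n p (+-cancelˡ-≡ r _ _ eq)))) (sym (δ-≢ y≢n))

  module Estimate (z : ℕ → ℕ) (z≤1 : ∀ v → z v ≤ 1) (z0 : z 0 ≡ 0) where
    open DigitCount {p} 1<p z z≤1 z0 public

    -- The level `j` is variable because extracting a power of `p` from a weight lowers the level up
    -- to which the remaining weight is known to be Lipschitz.
    WeightedBound : ℕ → Set
    WeightedBound n = ∀ j → j ≤ α (n /ℕ p) → ∀ g → Lipschitz j g → p ^ j ∣ 𝕊 g n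

    -- A weight that is constant up to p times a Lipschitz function gains a factor p.
    contracting-∣ : ∀ {n j} G → p ^ j ∣ S n → j ≤ α n → WeightedBound n →
      (∀ k → suc k ≤ j → ∀ x s → G (x ⊕ s ⊛ p ^ k) ≅ G x [ p ^ suc k ]) → p ^ j ∣ 𝕊 G n
    contracting-∣ {n} {zero}  G _ _ _ _ = 1∣ _
    contracting-∣ {n} {suc j} G p^j∣S j≤α bound contr = subst (p ^ suc j ∣_)
      (sym (𝕊-affine c p n G≡))
      (∣m∣n⇒∣m+n (∣n⇒∣m*n c p^j∣S)
        -- The weighted bound falls short of `α n` by at most one, which the factor `p` in front
        -- repairs.
        (*-monoʳ-∣ p (bound j (s≤s⁻¹ (≤-trans j≤α (α≤1+α-/ n))) (λ x → G x /ℕ p) Lip)))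
      where
      c = G 0ᵥ % p
      G≅ : ∀ x → G x ≅ G 0ᵥ [ p ]
      -- Contraction with `k = 0`: every `x` is the shift of the origin by `x ⊛ p ^ 0`.
      G≅ x = subst₂ (λ t m → G t ≅ G 0ᵥ [ m ]) (0⊕ x) (*-identityʳ p) (contr 0 (s≤s z≤n) 0ᵥ x)
      %-≅ : ∀ a → a ≅ a % p [ p ]
      %-≅ a = shifts 0 (a /ℕ p) (trans (+-identityʳ a) (m≡m%n+[m/n]*n a p))
      G%≡ : ∀ x → G x % p ≡ c
      G%≡ x = ≅⇒≡ (m%n<n (G x) p) (m%n<n (G 0ᵥ) p) (≅-trans (≅-sym (%-≅ (G x))) (≅-trans (G≅ x) (%-≅ (G 0ᵥ))))
      G≡ : ∀ x → G x ≡ c + p * (G x /ℕ p)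
      G≡ x = trans (m≡m%n+[m/n]*n (G x) p) (cong₂ _+_ (G%≡ x) (*-comm (G x /ℕ p) p))
      Lip : Lipschitz j (λ x → G x /ℕ p)
      Lip k k≤j x s = ≅-unscale p (≅-cancel-+ c
        (subst₂ (λ a b → a ≅ b [ p ^ suc k ]) (G≡ _) (G≡ x) (contr k (s≤s k≤j) x s)))

    module Step {v n : ℕ} (v<p : v < p) {j : ℕ} (j≤α : j ≤ α n) (p^j∣S : p ^ j ∣ S n)
                (bound : ∀ i → i ≤ n → WeightedBound i) (g : Vec ℕ d → ℕ) (g-Lip : Lipschitz j g) where

      m = v + n * p
      N = suc m

      n<N : n < N
      n<N = s≤s (≤-trans (m≤m*n n p) (m≤n+m (n * p) v))

      -- Modulo `p ^ j`, the factor by which `Q x` is multiplied to give the summand at `a ⊕ x ⊛ p`;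
      -- the part of the sum with last digits `a` is thus again a weighted sum.
      weight : Vec ℕ d → Vec ℕ d → ℕ
      weight a x = carryFactor∏ e a x * (unitRatio j (a ⊕ x ⊛ p) * g (a ⊕ x ⊛ p))

      Lip-at-digit : ∀ a {h : Vec ℕ d → ℕ} → Lipschitz j h → ∀ k → suc k ≤ j → ∀ x s →
                     h (a ⊕ (x ⊕ s ⊛ p ^ k) ⊛ p) ≅ h (a ⊕ x ⊛ p) [ p ^ suc k ]
      Lip-at-digit a {h} lip k k<j x s =
        ≅-trans (≅-reflexive (cong h (⊕-digit-shift a x s (p ^ k) p))) (lip (suc k) k<j (a ⊕ x ⊛ p) s)

      ratio-Lip : Lipschitz j (λ x → unitRatio j x * g x)
      ratio-Lip = Lipschitz-* (unitRatio-Lipschitz j) g-Lip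

      t≤carry : ∀ a → ∣ a ∣ᵥ /ℕ p ≤ carry e a
      t≤carry a with dominating a
      ... | i , ∣a∣≤ = ≤-trans (/-mono-≤ ∣a∣≤ ≤-refl) (lookup≤sumᵥ (λ w → w · a /ℕ p) e i)

      -- Without a carry from `∣ a ∣ᵥ` the weight is only known to contract, and both claims at `n`
      -- are used. With `t` carries, domination extracts `p ^ t`, and `α-+` shows that the weighted
      -- claim at `n₀ = n - t` covers the missing `j ∸ t`.
      weight-∣ : ∀ a n₀ → ∣ a ∣ᵥ /ℕ p + n₀ ≡ n → p ^ j ∣ 𝕊 (weight a) n₀
      weight-∣ a n₀ eq with ∣ a ∣ᵥ /ℕ p in t≡
      ... | zero with refl ← eq = contracting-∣ (weight a) p^j∣S j≤α (bound n ≤-refl)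
        (λ k k<j x s → ≅-* (carryFactor∏-shift e k a x s) (Lip-at-digit a ratio-Lip k k<j x s))
      -- The subtraction is truncated: for `t` above `j` the factor `p ^ t` alone is enough.
      ... | suc t' = ∣-trans (subst (p ^ j ∣_) (^-distribˡ-+-* p t (j ∸ t)) (^-∣ p (m≤n+m∸n j t)))
        (subst (p ^ t * p ^ (j ∸ t) ∣_) (sym (𝕊-affine 0 (p ^ t) n₀ weight≡))
          (*-monoʳ-∣ (p ^ t) (bound n₀ n₀≤n (j ∸ t) j∸t≤ H H-Lip)))
        where
        t = suc t'
        H : Vec ℕ d → ℕ
        H x = (p ^ (carry e a ∸ t) * rise∏ e a x) * (unitRatio j (a ⊕ x ⊛ p) * g (a ⊕ x ⊛ p))
        ring : ∀ a b c d → a * b * c * d ≡ a * (b * c * d)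
        ring = solve-∀
        weight≡ : ∀ x → weight a x ≡ p ^ t * H x
        weight≡ x = trans (cong (_* (unitRatio j (a ⊕ x ⊛ p) * g (a ⊕ x ⊛ p))) (trans (carryFactor∏≡ e a x)
          (cong (_* rise∏ e a x) (trans (cong (p ^_) (sym (m+[n∸m]≡n (subst (_≤ carry e a) t≡ (t≤carry a)))))
            (^-distribˡ-+-* p t (carry e a ∸ t)))))) (ring (p ^ t) (p ^ (carry e a ∸ t)) (rise∏ e a x) _)
        n₀≤n : n₀ ≤ n
        n₀≤n = subst (n₀ ≤_) eq (m≤n+m n₀ t)
        j∸t≤ : j ∸ t ≤ α (n₀ /ℕ p)
        j∸t≤ = m≤n+o⇒m∸n≤o j t (≤-trans j≤α (subst (λ i → α i ≤ t + α (n₀ /ℕ p))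
          (trans (+-comm n₀ t) eq) (α-+ n₀ t (s≤s z≤n))))
        H-Lip : Lipschitz (j ∸ t) H
        H-Lip k k≤ x s = ≅-* (≅-*ˡ (p ^ (carry e a ∸ t)) (rise∏-shift e k a x s))
          (≅-trans (≅-reflexive (cong (λ y → unitRatio j y * g y)
              (trans (⊕-digit-shift a x s (p ^ k) p) (cong ((a ⊕ x ⊛ p) ⊕_) (⊛-assoc s p (p ^ k))))))
            (ratio-Lip k (≤-trans k≤ (m∸n≤m j t)) (a ⊕ x ⊛ p) (s ⊛ p)))

      size : ∀ (a x : Vec ℕ d) → ∣ a ⊕ x ⊛ p ∣ᵥ ≡ ∣ a ∣ᵥ + ∣ x ∣ᵥ * p
      size a x = trans (∣∣-⊕ a (x ⊛ p)) (cong (∣ a ∣ᵥ +_) (∣∣-⊛ x p))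

      δ-size : ∀ (a x : Vec ℕ d) → ∣ a ∣ᵥ % p ≡ v → δ ∣ a ⊕ x ⊛ p ∣ᵥ m ≡ δ (∣ a ∣ᵥ /ℕ p + ∣ x ∣ᵥ) n
      δ-size a x r≡v = trans
        (cong (λ s → δ s m) (trans (size a x) (trans (cong (_+ ∣ x ∣ᵥ * p) (m≡m%n+[m/n]*n ∣ a ∣ᵥ p))
          (ring (∣ a ∣ᵥ % p) (∣ a ∣ᵥ /ℕ p) ∣ x ∣ᵥ p))))
        (δ-digits (∣ a ∣ᵥ /ℕ p + ∣ x ∣ᵥ) n r≡v)
        where
        ring : ∀ r t y p → (r + t * p) + y * p ≡ r + (t + y) * p
        ring = solve-∀

      -- Comparing sums of coordinates, the fibre is empty unless `∣ a ∣ᵥ` ends in the digit `v` and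
      -- its carry is at most `n`; otherwise the carry lowers the size of the remaining sum from `n`
      -- to `n₀`.
      fibre-≅0 : ∀ a → All (_< p) a →
        box∑ d N (λ x → δ ∣ a ⊕ x ⊛ p ∣ᵥ m * (Q (a ⊕ x ⊛ p) * g (a ⊕ x ⊛ p))) ≅ 0 [ p ^ j ]
      fibre-≅0 a a<p with ∣ a ∣ᵥ % p ≟ v
      ... | no  r≢v = ≅-reflexive (trans (box∑-cong d N (λ x _ → cong (_* _) (δ-≢ (r≢v ∘ last-digit x)))) (box∑-zero d N))
        where
        last-digit : ∀ x → ∣ a ⊕ x ⊛ p ∣ᵥ ≡ m → ∣ a ∣ᵥ % p ≡ v
        last-digit x eq = trans (sym ([m+kn]%n≡m%n ∣ a ∣ᵥ ∣ x ∣ᵥ p))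
          (trans (cong (_% p) (trans (sym (size a x)) eq)) (digit-% n v<p))
      ... | yes r≡v with ∣ a ∣ᵥ /ℕ p ≤? n
      ...   | no  t≰n = ≅-reflexive (trans (box∑-cong d N (λ x _ → cong (_* _) (vanish x))) (box∑-zero d N))
        where
        vanish : ∀ x → δ ∣ a ⊕ x ⊛ p ∣ᵥ m ≡ 0
        vanish x = trans (δ-size a x r≡v) (δ-≢ (λ eq → t≰n (subst (∣ a ∣ᵥ /ℕ p ≤_) eq (m≤m+n _ _))))
      ...   | yes t≤n = ≅-trans (box∑-≅ d N (λ x _ → ≅-* (≅-reflexive (restrict x)) (summand x)))
          (≅-trans (≅-reflexive (sym (𝕊-box (weight a) n₀<N))) (∣⇒≅0 (weight-∣ a n₀ t+n₀≡n)))
        where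
        n₀ = n ∸ ∣ a ∣ᵥ /ℕ p
        t+n₀≡n : ∣ a ∣ᵥ /ℕ p + n₀ ≡ n
        t+n₀≡n = m+[n∸m]≡n t≤n
        n₀<N : n₀ < N
        n₀<N = ≤-<-trans (m∸n≤m n (∣ a ∣ᵥ /ℕ p)) n<N
        restrict : ∀ x → δ ∣ a ⊕ x ⊛ p ∣ᵥ m ≡ δ ∣ x ∣ᵥ n₀
        restrict x = trans (δ-size a x r≡v)
          (trans (cong (δ (∣ a ∣ᵥ /ℕ p + ∣ x ∣ᵥ)) (sym t+n₀≡n)) (δ-cancelˡ (∣ a ∣ᵥ /ℕ p) ∣ x ∣ᵥ n₀))
        ring : ∀ a b c d → a * (b * c) * d ≡ a * (b * (c * d))
        ring = solve-∀
        summand : ∀ x → Q (a ⊕ x ⊛ p) * g (a ⊕ x ⊛ p) ≅ Q x * weight a x [ p ^ j ]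
        summand x = ≅-trans (≅-*ʳ (g (a ⊕ x ⊛ p)) (Q-digits-≅ j a x a<p))
          (≅-reflexive (ring (Q x) (carryFactor∏ e a x) (unitRatio j (a ⊕ x ⊛ p)) (g (a ⊕ x ⊛ p))))

      𝕊-∣ : p ^ j ∣ 𝕊 g m
      𝕊-∣ = ≅0⇒∣ (≅-trans (≅-reflexive (trans (𝕊-box g (≤-trans (n<1+n m) (m≤m*n N p))) (box∑-digits d p N _)))
        (≅-trans (box∑-≅ d p fibre-≅0) (≅-reflexive (box∑-zero d p))))

-- The recurrence and the main induction

list∑-tabulate-≅ : ∀ {A : Set} {m n} {φ ψ : A → ℕ} (h : Fin n → A) →
  (∀ i → φ (h i) ≅ ψ (h i) [ m ]) → list∑ φ (List.tabulate h) ≅ list∑ ψ (List.tabulate h) [ m ]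
list∑-tabulate-≅ {n = zero}  h eq = ≅-refl
list∑-tabulate-≅ {n = suc n} h eq = ≅-+ (eq Fin.zero) (list∑-tabulate-≅ (h ∘ Fin.suc) (eq ∘ Fin.suc))

list∑-*ʳ : ∀ {A : Set} (φ : A → ℕ) c xs → list∑ (λ x → φ x * c) xs ≡ list∑ φ xs * c
list∑-*ʳ φ c []       = refl
list∑-*ʳ φ c (x ∷ xs) = trans (cong (φ x * c +_) (list∑-*ʳ φ c xs)) (sym (*-distribʳ-+ c (φ x) _))

module Valuations {p : ℕ} .{{_ : NonZero p}} (pr : Prime p) {d u l : ℕ}
                  (e : Vec (Vec ℕ d) u) (ks : Vec (Fin d) l)
                  (balanced : vsum e ≡ vsum (unitTuple ks)) (dominating : Dominating e) where

  open PrimePart {p} pr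
  open WeightedSums {p} pr e ks balanced dominating public

  z : ℕ → ℕ
  z v with p ∣? S v
  ... | yes _ = 1
  ... | no  _ = 0

  z≤1 : ∀ v → z v ≤ 1
  z≤1 v with p ∣? S v
  ... | yes _ = ≤-refl
  ... | no  _ = z≤n

  z-∣ : ∀ {v} → p ∣ S v → z v ≡ 1
  z-∣ {v} p∣S with p ∣? S v
  ... | yes _   = refl
  ... | no  p∤S = ⊥-elim (p∤S p∣S)

  z0 : z 0 ≡ 0
  z0 with p ∣? S 0
  ... | yes p∣S0 = ⊥-elim (p∤1 (subst (p ∣_) S-0 p∣S0))
  ... | no  _    = refl

  open Estimate z z≤1 z0 public

  term : ∀ {q} → (Fin (suc q) → ℕ → ℕ) → ℕ → Fin (suc q) → ℕ
  term c N k with toℕ k ≤? N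
  ... | yes _ = c k (N ∸ toℕ k) * S (N ∸ toℕ k)
  ... | no  _ = 0

  -- the residues modulo p ^ suc (α n) of the recurrence defined by the differential operator
  record Recurrence (q n : ℕ) : Set where
    field
      c        : Fin (suc q) → ℕ → ℕ
      vanishes : ∀ N → list∑ (term c N) (List.allFin (suc q)) ≅ 0 [ p ^ suc (α n) ]
      periodic : ∀ k M s → c k (M + s * p) ≅ c k M [ p ]
      -- At `w = 0` the recurrence reads `c Fin.zero 0 * S 0 ≅ 0` with `S 0 ≡ 1`, so the leading
      -- coefficient is not a unit there.
      unit     : ∀ w → 0 < w → w < p → Σ ℕ λ y → c Fin.zero w * y ≅ 1 [ p ^ suc (α n) ]
      -- For `k` beyond `w` the index falls below `n * p`, into an earlier block without counterpart
      -- in the recurrence at `w`; such terms must vanish by themselves.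
      remote   : ∀ k w → 0 < w → w < p → w < toℕ k → toℕ k ≤ w + n * p →
                 p ^ α (w + n * p ∸ toℕ k) ∣ S (w + n * p ∸ toℕ k) →
                 p ^ suc (α n) ∣ c k (w + n * p ∸ toℕ k) * S (w + n * p ∸ toℕ k)

  module _ {q n : ℕ} (rec : Recurrence q n) {v : ℕ} (v<p : v < p)
           (near : ∀ w → w ≤ v → p ^ α n ∣ S (w + n * p))
           (below : ∀ M → M < v + n * p → p ^ α M ∣ S M) where
    open Recurrence rec

    -- Modulo p, the sequence w ↦ S (w + n * p) / p ^ α n satisfies the recurrence of S.
    lucas : ∀ w → w ≤ v → S (w + n * p) ≅ S w * S (n * p) [ p ^ suc (α n) ]
    lucas = <-rec _ step
      where
      step : ∀ w → (∀ {i} → i < w → i ≤ v → S (i + n * p) ≅ S i * S (n * p) [ p ^ suc (α n) ]) →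
             w ≤ v → S (w + n * p) ≅ S w * S (n * p) [ p ^ suc (α n) ]
      step zero ih _ = ≅-reflexive (sym (trans (cong (_* S (n * p)) S-0) (*-identityˡ _)))
      step w@(suc w') ih w≤v =
        ≅-cancel-unit (c Fin.zero w) (proj₂ (unit w z<s (≤-<-trans w≤v v<p)))
          (≅-trans (≅-sym (≅-lift (α n) (periodic Fin.zero w n) (near w w≤v)))
            (≅-trans heads (≅-reflexive (*-assoc (c Fin.zero w) (S w) (S (n * p))))))
        where
        N = w + n * p
        scaled : Fin (suc q) → ℕ
        scaled k = term c w k * S (n * p)
        tails : ∀ k → term c N (Fin.suc k) ≅ scaled (Fin.suc k) [ p ^ suc (α n) ]
        tails k with suc (toℕ k) ≤? w | suc (toℕ k) ≤? N
        ... | yes k<w | no  k≮N = ⊥-elim (k≮N (≤-trans k<w (m≤m+n w (n * p))))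
        ... | no  _   | no  _   = ≅-refl
        ... | no  k≮w | yes k<N = ∣⇒≅0 (remote (Fin.suc k) w z<s (≤-<-trans w≤v v<p) (≰⇒> k≮w) k<N
            (below _ (<-≤-trans (∸-monoʳ-< z<s k<N) (+-monoˡ-≤ (n * p) w≤v))))
        ... | yes k<w | yes k<N = subst
            (λ M → c (Fin.suc k) M * S M ≅ c (Fin.suc k) i * S i * S (n * p) [ p ^ suc (α n) ])
            (sym (+-∸-comm (n * p) k<w))
            (≅-trans (≅-lift (α n) (periodic (Fin.suc k) i n) (near i i≤v))
              (≅-trans (≅-*ˡ (c (Fin.suc k) i) (ih (∸-monoʳ-< z<s k<w) i≤v))
                (≅-reflexive (sym (*-assoc (c (Fin.suc k) i) (S i) (S (n * p)))))))
          where
          i = w ∸ suc (toℕ k)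
          i≤v : i ≤ v
          i≤v = ≤-trans (m∸n≤m w (suc (toℕ k))) w≤v
        -- The recurrence at `N` and `S (n * p)` times the recurrence at `w` both vanish; cancelling
        -- the congruent tails leaves the terms with `k = 0`.
        heads : c Fin.zero N * S N ≅ c Fin.zero w * S w * S (n * p) [ p ^ suc (α n) ]
        heads = ≅-cancelʳ-+ (list∑-tabulate-≅ {ψ = scaled} Fin.suc tails)
          (≅-trans (vanishes N) (≅-sym (≅-trans (≅-reflexive (list∑-*ʳ (term c w) (S (n * p)) (List.allFin (suc q))))
            (≅-*ʳ (S (n * p)) (vanishes w)))))

  constant-Lipschitz : ∀ j c → Lipschitz {d} j (λ _ → c)
  constant-Lipschitz j c k k≤j x s = ≅-refl

  valuations : ∀ {q} → (∀ n → Recurrence q n) → ∀ m → WeightedBound m × p ^ α m ∣ S m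
  valuations {q} rec = <-rec _ step
    where
    step : ∀ m → (∀ {i} → i < m → WeightedBound i × p ^ α i ∣ S i) → WeightedBound m × p ^ α m ∣ S m
    step zero ih = trivial , 1∣ _
      where
      trivial : WeightedBound 0
      trivial j j≤ g _ with n≤0⇒n≡0 (≤-trans j≤ (α-/≤ 0))
      ... | refl = 1∣ _
    step m@(suc _) ih = subst (λ i → WeightedBound i × p ^ α i ∣ S i) (sym (m≡m%n+[m/n]*n m p))
      (weighted v v<p , plain)
      where
      v = m % p
      n = m /ℕ p
      v<p : v < p
      v<p = m%n<n m p
      n<m : n < m
      n<m = m/n<m m p 1<p
      -- The whole block above `n` is covered at once, since only indices up to `n`, hence below
      -- `m`, are consulted.
      weighted : ∀ w → w < p → WeightedBound (w + n * p)
      weighted w w<p j j≤ g g-Lip = Step.𝕊-∣ w<p j≤α (∣-trans (^-∣ p j≤α) (proj₂ (ih n<m)))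
        (λ i i≤n → proj₁ (ih (≤-<-trans i≤n n<m))) g g-Lip
        where
        j≤α : j ≤ α n
        j≤α = subst (λ i → j ≤ α i) (digit-/ n w<p) j≤
      near : ∀ w → w ≤ v → p ^ α n ∣ S (w + n * p)
      near w w≤v = subst (p ^ α n ∣_) (𝕊-1 (w + n * p)) (weighted w w<p (α n)
        (≤-reflexive (cong α (sym (digit-/ n w<p)))) (λ _ → 1) (constant-Lipschitz (α n) 1))
        where
        w<p = ≤-<-trans w≤v v<p
      below : ∀ M → M < v + n * p → p ^ α M ∣ S M
      below M M< = proj₂ (ih (subst (M <_) (sym (m≡m%n+[m/n]*n m p)) M<))
      plain : p ^ α (v + n * p) ∣ S (v + n * p)
      plain = subst (λ i → p ^ i ∣ S (v + n * p)) (sym (α-digit n v<p)) counted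
        where
        counted : p ^ (z v + α n) ∣ S (v + n * p)
        counted with p ∣? S v
        ... | no  _   = near v ≤-refl
        ... | yes p∣S = ≅∣ (lucas (rec n) v<p near below v ≤-refl) (*-pres-∣ p∣S (near 0 z≤n))

-- Residues of p-adic integers

module Approximation (p : ℕ) .{{_ : NonZero p}} where

  infix 9 _⟦_⟧
  _⟦_⟧ : ℤₚ p → ℕ → ℕ
  x ⟦ k ⟧ = approx p x k

  approx< : ∀ x k → x ⟦ k ⟧ < p ^ k
  approx< x zero    = z<s
  approx< x (suc k) = <-≤-trans (+-monoˡ-< (toℕ (x k) * p ^ k) (approx< x k)) (*-monoˡ-≤ (p ^ k) (toℕ<n (x k)))

  approx-suc : ∀ x k → x ⟦ suc k ⟧ ≅ x ⟦ k ⟧ [ p ^ k ]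
  approx-suc x k = shifts 0 (toℕ (x k)) (+-identityʳ _)

  Compatible : (ℕ → ℕ) → Set
  Compatible a = ∀ k → a (suc k) ≅ a k [ p ^ k ]

  lower : ∀ {a b} k → a ≅ b [ p ^ suc k ] → a ≅ b [ p ^ k ]
  lower k = ≅-weaken (n∣m*n p)

  -- By induction and compatibility the first `k` digits are those of `a (suc k)`, from which the
  -- next digit is read as well. The shift `s` is the part of `a (suc k)` above those digits.
  approx-fromApprox : ∀ a → Compatible a → ∀ k → fromApprox p a ⟦ k ⟧ ≅ a k [ p ^ k ]
  approx-fromApprox a compat zero    = ≅-mod1
  approx-fromApprox a compat (suc k) = shifts s 0 (begin
    (A + toℕ (fromApprox p a k) * p ^ k) + s * (p * p ^ k)
      ≡⟨ cong₂ (λ x y → x + y * p ^ k + s * (p * p ^ k)) A≡ (toℕ-fromℕ< (m%n<n (b /ℕ p ^ k) p)) ⟩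
    (b % p ^ k + (b /ℕ p ^ k) % p * p ^ k) + s * (p * p ^ k)
      ≡⟨ ring (b % p ^ k) ((b /ℕ p ^ k) % p) (p ^ k) s p ⟩
    b % p ^ k + ((b /ℕ p ^ k) % p + s * p) * p ^ k
      ≡⟨ cong (λ x → b % p ^ k + x * p ^ k) (m≡m%n+[m/n]*n (b /ℕ p ^ k) p) ⟨
    b % p ^ k + (b /ℕ p ^ k) * p ^ k
      ≡⟨ m≡m%n+[m/n]*n b (p ^ k) ⟨
    b
      ≡⟨ +-identityʳ b ⟨
    b + 0 ∎)
    where
    open ≡-Reasoning
    instance
      p^k≢0 : NonZero (p ^ k)
      p^k≢0 = m^n≢0 p k
    A = fromApprox p a ⟦ k ⟧
    b = a (suc k)
    s = (b /ℕ p ^ k) /ℕ p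
    %-≅ : b % p ^ k ≅ b [ p ^ k ]
    %-≅ = shifts (b /ℕ p ^ k) 0 (trans (sym (m≡m%n+[m/n]*n b (p ^ k))) (sym (+-identityʳ b)))
    A≡ : A ≡ b % p ^ k
    A≡ = ≅⇒≡ (approx< (fromApprox p a) k) (m%n<n b (p ^ k))
      (≅-trans (approx-fromApprox a compat k) (≅-sym (≅-trans %-≅ (compat k))))
    ring : ∀ x y q s p → (x + y * q) + s * (p * q) ≡ x + (y + s * p) * q
    ring = solve-∀

  approx-ι : ∀ n k → ιℕ p n ⟦ k ⟧ ≅ n [ p ^ k ]
  approx-ι n = approx-fromApprox (λ _ → n) (λ _ → ≅-refl)

  approx-+ : ∀ x y k → _+ₚ_ p x y ⟦ k ⟧ ≅ x ⟦ k ⟧ + y ⟦ k ⟧ [ p ^ k ]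
  approx-+ x y = approx-fromApprox _ (λ k → ≅-+ (approx-suc x k) (approx-suc y k))

  approx-* : ∀ x y k → _*ₚ_ p x y ⟦ k ⟧ ≅ x ⟦ k ⟧ * y ⟦ k ⟧ [ p ^ k ]
  approx-* x y = approx-fromApprox _ (λ k → ≅-* (approx-suc x k) (approx-suc y k))

  approx-neg : ∀ x k → -ₚ_ p x ⟦ k ⟧ + x ⟦ k ⟧ ≅ 0 [ p ^ k ]
  approx-neg x k = ≅-trans (≅-+ (approx-fromApprox _ compat k) ≅-refl) (cancels k)
    where
    cancels : ∀ k → (p ^ k ∸ x ⟦ k ⟧) + x ⟦ k ⟧ ≅ 0 [ p ^ k ]
    cancels k = ≅-trans (≅-reflexive (m∸n+n≡m (<⇒≤ (approx< x k)))) (∣⇒≅0 ∣-refl)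
    compat : Compatible (λ k → p ^ k ∸ x ⟦ k ⟧)
    compat k = ≅-cancelʳ-+ (approx-suc x k) (≅-trans (lower k (cancels (suc k))) (≅-sym (cancels k)))

  approx-shift : ∀ x k i → x ⟦ k + i ⟧ ≅ x ⟦ k ⟧ [ p ^ k ]
  approx-shift x k zero    = ≅-reflexive (cong (x ⟦_⟧) (+-identityʳ k))
  approx-shift x k (suc i) = ≅-trans (≅-reflexive (cong (x ⟦_⟧) (+-suc k i)))
    (≅-trans (≅-weaken (^-∣ p (m≤m+n k i)) (approx-suc x (k + i))) (approx-shift x k i))

  approx-≤ : ∀ x {k j} → k ≤ j → x ⟦ j ⟧ ≅ x ⟦ k ⟧ [ p ^ k ]
  approx-≤ x {k} {j} k≤j = subst (λ i → x ⟦ i ⟧ ≅ x ⟦ k ⟧ [ p ^ k ]) (m+[n∸m]≡n k≤j) (approx-shift x k (j ∸ k))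

  ≈⇒approx≡ : ∀ {x y} → _≈ₚ_ p x y → ∀ k → x ⟦ k ⟧ ≡ y ⟦ k ⟧
  ≈⇒approx≡ x≈y zero    = refl
  ≈⇒approx≡ x≈y (suc k) = cong₂ (λ a b → a + toℕ b * p ^ k) (≈⇒approx≡ x≈y k) (x≈y k)

  ≈⇒≅ : ∀ {x y} → _≈ₚ_ p x y → ∀ k → x ⟦ k ⟧ ≅ y ⟦ k ⟧ [ p ^ k ]
  ≈⇒≅ x≈y k = ≅-reflexive (≈⇒approx≡ x≈y k)

  ≅⇒≈ : ∀ {x y} → (∀ k → x ⟦ k ⟧ ≅ y ⟦ k ⟧ [ p ^ k ]) → _≈ₚ_ p x y
  ≅⇒≈ {x} {y} eq i = toℕ-injective (*-cancelʳ-≡ _ _ (p ^ i) {{m^n≢0 p i}}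
    (+-cancelˡ-≡ (x ⟦ i ⟧) _ _ (trans (approx≡ (suc i)) (cong (_+ toℕ (y i) * p ^ i) (sym (approx≡ i))))))
    where
    approx≡ : ∀ k → x ⟦ k ⟧ ≡ y ⟦ k ⟧
    approx≡ k = ≅⇒≡ (approx< x k) (approx< y k) (eq k)

  divideBy : ℕ → ℤₚ p → ℤₚ p
  divideBy j x i = x (j + i)

  approx-divideBy : ∀ j x k → x ⟦ j + k ⟧ ≡ x ⟦ j ⟧ + p ^ j * divideBy j x ⟦ k ⟧
  approx-divideBy j x zero    = trans (cong (x ⟦_⟧) (+-identityʳ j)) (ring (x ⟦ j ⟧) (p ^ j))
    where
    ring : ∀ a b → a ≡ a + b * 0
    ring = solve-∀
  approx-divideBy j x (suc k) = begin
    x ⟦ j + suc k ⟧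
      ≡⟨ cong (x ⟦_⟧) (+-suc j k) ⟩
    x ⟦ j + k ⟧ + D * p ^ (j + k)
      ≡⟨ cong₂ (λ a b → a + D * b) (approx-divideBy j x k) (^-distribˡ-+-* p j k) ⟩
    x ⟦ j ⟧ + p ^ j * divideBy j x ⟦ k ⟧ + D * (p ^ j * p ^ k)
      ≡⟨ ring (x ⟦ j ⟧) (p ^ j) (divideBy j x ⟦ k ⟧) D (p ^ k) ⟩
    x ⟦ j ⟧ + p ^ j * (divideBy j x ⟦ k ⟧ + D * p ^ k) ∎
    where
    open ≡-Reasoning
    D = toℕ (x (j + k))
    ring : ∀ a b c d q → a + b * c + d * (b * q) ≡ a + b * (c + d * q)
    ring = solve-∀

  divideBy-≅ : ∀ j x → p ^ j ∣ x ⟦ j ⟧ → ∀ k → x ⟦ k ⟧ ≅ p ^ j * divideBy j x ⟦ k ⟧ [ p ^ k ]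
  divideBy-≅ j x p^j∣ k = ≅-trans (≅-sym (approx-≤ x (m≤n+m k j)))
    (≅-reflexive (trans (approx-divideBy j x k) (cong (_+ p ^ j * divideBy j x ⟦ k ⟧) x⟦j⟧≡0)))
    where
    x⟦j⟧≡0 : x ⟦ j ⟧ ≡ 0
    x⟦j⟧≡0 = ≅⇒≡ (approx< x j) (m^n>0 p j) (∣⇒≅0 p^j∣)

  ∈p^⇒≅ : ∀ x y t → _∈p^_ℤₚ p (_-ₚ_ p x y) t → x ⟦ t ⟧ ≅ y ⟦ t ⟧ [ p ^ t ]
  ∈p^⇒≅ x y t (w , eq) = ≅-cancelʳ-+ (≅-refl {a = n}) (≅-trans (≅-sym (approx-+ x (-ₚ_ p y) t))
    (≅-trans (≈⇒≅ eq t) (≅-trans (≅-trans (approx-* (ιℕ p (p ^ t)) w t)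
      (≅-*ʳ (w ⟦ t ⟧) (≅-trans (approx-ι (p ^ t) t) (∣⇒≅0 ∣-refl))))
      (≅-sym (≅-trans (≅-reflexive (+-comm (y ⟦ t ⟧) n)) (approx-neg y t))))))
    where
    n = -ₚ_ p y ⟦ t ⟧

  -- Evaluation of polynomials modulo p ^ k

  evalMod : ℕ → Poly p → ℕ → ℕ
  evalMod k []       m = 0
  evalMod k (c ∷ cs) m = c ⟦ k ⟧ + m * evalMod k cs m

  -- The modulus `r` is independent of the precision `k`: once the coefficients are truncated,
  -- `evalMod k P` is an ordinary integer polynomial. Hence the period `p` of the recurrence
  -- coefficients.
  evalMod-cong : ∀ {r m m'} k P → m ≅ m' [ r ] → evalMod k P m ≅ evalMod k P m' [ r ]
  evalMod-cong k []       m≅m' = ≅-refl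
  evalMod-cong k (c ∷ cs) m≅m' = ≅-+ (≅-refl {a = c ⟦ k ⟧}) (≅-* m≅m' (evalMod-cong k cs m≅m'))

  approx-evalP : ∀ P m k → evalP p P (ιℕ p m) ⟦ k ⟧ ≅ evalMod k P m [ p ^ k ]
  approx-evalP []       m k = approx-ι 0 k
  approx-evalP (c ∷ cs) m k = ≅-trans (approx-+ c _ k) (≅-+ (≅-refl {a = c ⟦ k ⟧})
    (≅-trans (approx-* (ιℕ p m) (evalP p cs (ιℕ p m)) k) (≅-* (approx-ι m k) (approx-evalP cs m k))))

  evalMod-≈0 : ∀ k m P → (∀ j → _≈ₚ_ p (coeff p P j) (0ₚ p)) → evalMod k P m ≅ 0 [ p ^ k ]
  evalMod-≈0 k m []       eq = ≅-refl
  evalMod-≈0 k m (c ∷ cs) eq = ≅-trans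
    (≅-+ (≅-trans (≈⇒≅ (eq 0) k) (approx-ι 0 k)) (≅-*ˡ m (evalMod-≈0 k m cs (eq ∘ suc))))
    (≅-reflexive (*-zeroʳ m))

  evalMod-≈P : ∀ k m P R → _≈P_ p P R → evalMod k P m ≅ evalMod k R m [ p ^ k ]
  evalMod-≈P k m []       R        eq = ≅-sym (evalMod-≈0 k m R (λ j i → sym (eq j i)))
  evalMod-≈P k m (c ∷ cs) []       eq = evalMod-≈0 k m (c ∷ cs) eq
  evalMod-≈P k m (c ∷ cs) (b ∷ bs) eq = ≅-+ (≈⇒≅ (eq 0) k) (≅-*ˡ m (evalMod-≈P k m cs bs (eq ∘ suc)))

  evalMod-addP : ∀ k m P R → evalMod k (addP p P R) m ≅ evalMod k P m + evalMod k R m [ p ^ k ]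
  evalMod-addP k m []       R        = ≅-refl
  evalMod-addP k m (c ∷ cs) []       = ≅-reflexive (sym (+-identityʳ _))
  evalMod-addP k m (c ∷ cs) (b ∷ bs) = ≅-trans
    (≅-+ (approx-+ c b k) (≅-*ˡ m (evalMod-addP k m cs bs)))
    (≅-reflexive (ring (c ⟦ k ⟧) (b ⟦ k ⟧) m (evalMod k cs m) (evalMod k bs m)))
    where
    ring : ∀ c b m s t → (c + b) + m * (s + t) ≡ (c + m * s) + (b + m * t)
    ring = solve-∀

  evalMod-scale : ∀ k m a P → evalMod k (List.map (_*ₚ_ p a) P) m ≅ a ⟦ k ⟧ * evalMod k P m [ p ^ k ]
  evalMod-scale k m a []       = ≅-reflexive (sym (*-zeroʳ (a ⟦ k ⟧)))
  evalMod-scale k m a (c ∷ cs) = ≅-trans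
    (≅-+ (approx-* a c k) (≅-*ˡ m (evalMod-scale k m a cs)))
    (≅-reflexive (ring (a ⟦ k ⟧) (c ⟦ k ⟧) m (evalMod k cs m)))
    where
    ring : ∀ a c m s → a * c + m * (a * s) ≡ a * (c + m * s)
    ring = solve-∀

  evalMod-mulP : ∀ k m P R → evalMod k (mulP p P R) m ≅ evalMod k P m * evalMod k R m [ p ^ k ]
  evalMod-mulP k m []       R = ≅-refl
  evalMod-mulP k m (a ∷ as) R = ≅-trans (evalMod-addP k m (List.map (_*ₚ_ p a) R) (0ₚ p ∷ mulP p as R))
    (≅-trans (≅-+ (evalMod-scale k m a R) (≅-+ (approx-ι 0 k) (≅-*ˡ m (evalMod-mulP k m as R))))
      (≅-reflexive (ring (a ⟦ k ⟧) m (evalMod k as m) (evalMod k R m))))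
    where
    ring : ∀ a m s r → a * r + m * (s * r) ≡ (a + m * s) * r
    ring = solve-∀

  evalMod-X+ : ∀ k m i → evalMod k (X+ p i) m ≅ i + m [ p ^ k ]
  evalMod-X+ k m i = ≅-trans (≅-+ (approx-ι i k) (≅-*ˡ m (≅-+ (approx-ι 1 k) (≅-refl {a = m * 0}))))
    (≅-reflexive (ring i m))
    where
    ring : ∀ i m → i + m * (1 + m * 0) ≡ i + m
    ring = solve-∀

  private
    up∏ : (ℕ → ℕ) → ℕ → ℕ → ℕ
    up∏ h zero    m = 1
    up∏ h (suc l) m = (h 0 + m) * up∏ (h ∘ suc) l m

    up∏-snoc : ∀ h l m → up∏ h (suc l) m ≡ (h l + m) * up∏ h l m
    up∏-snoc h zero    m = refl
    up∏-snoc h (suc l) m = trans (cong ((h 0 + m) *_) (up∏-snoc (h ∘ suc) l m))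
      (ring (h 0 + m) (h (suc l) + m) (up∏ (h ∘ suc) l m))
      where
      ring : ∀ a b c → a * (b * c) ≡ b * (a * c)
      ring = solve-∀

    up∏-rise : ∀ l m → up∏ suc l m ≡ rise m l
    up∏-rise zero    m = refl
    up∏-rise (suc l) m = trans (up∏-snoc suc l m) (cong ((suc l + m) *_) (up∏-rise l m))

  evalMod-prodSq : ∀ k m i → evalMod k (prodSq p i) m ≅ rise m (i ∸ 1) * rise m (i ∸ 1) [ p ^ k ]
  evalMod-prodSq k m i = ≅-trans (go suc (i ∸ 1)) (≅-reflexive (cong (λ t → t * t) (up∏-rise (i ∸ 1) m)))
    where
    ring₀ : ∀ m → 1 + m * 0 ≡ 1
    ring₀ = solve-∀
    ring : ∀ a b → a * a * (b * b) ≡ a * b * (a * b)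
    ring = solve-∀
    squares : (ℕ → ℕ) → ℕ → Poly p
    squares h l = List.foldr (λ i acc → mulP p (mulP p (X+ p i) (X+ p i)) acc) (1ₚ p ∷ []) (List.applyUpTo h l)
    go : ∀ h l → evalMod k (squares h l) m ≅ up∏ h l m * up∏ h l m [ p ^ k ]
    go h zero    = ≅-trans (≅-+ (approx-ι 1 k) ≅-refl) (≅-reflexive (ring₀ m))
    go h (suc l) = ≅-trans (evalMod-mulP k m (mulP p (X+ p (h 0)) (X+ p (h 0))) (squares (h ∘ suc) l))
      (≅-trans (≅-* (≅-trans (evalMod-mulP k m (X+ p (h 0)) (X+ p (h 0))) (≅-* (evalMod-X+ k m (h 0)) (evalMod-X+ k m (h 0))))
          (go (h ∘ suc) l))
        (≅-reflexive (ring (h 0 + m) (up∏ (h ∘ suc) l m))))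

  monomial-shift : ∀ {d} k (a x s : Vec ℕ d) → monomial p a (x ⊕ s ⊛ p ^ k) ≅ monomial p a x [ p ^ k ]
  monomial-shift k []      []      []      = ≅-refl
  monomial-shift k (a ∷ b) (x ∷ y) (s ∷ t) =
    ≅-* (≅-^ a (shifts 0 s (+-identityʳ _))) (monomial-shift k b y t)

  evalM-shift : ∀ {d} k (P : MPoly p d) x s → evalM p P (x ⊕ s ⊛ p ^ k) ⟦ k ⟧ ≅ evalM p P x ⟦ k ⟧ [ p ^ k ]
  evalM-shift k []            x s = ≅-refl
  evalM-shift k ((c , a) ∷ P) x s = ≅-trans (expand (x ⊕ s ⊛ p ^ k))
    (≅-trans (≅-+ (≅-*ˡ (c ⟦ k ⟧) (monomial-shift k a x s)) (evalM-shift k P x s)) (≅-sym (expand x)))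
    where
    expand : ∀ y → evalM p ((c , a) ∷ P) y ⟦ k ⟧ ≅ c ⟦ k ⟧ * monomial p a y + evalM p P y ⟦ k ⟧ [ p ^ k ]
    expand y = ≅-trans (approx-+ _ _ k) (≅-+ (≅-trans (approx-* c _ k) (≅-*ˡ (c ⟦ k ⟧) (approx-ι _ k))) ≅-refl)

  lookup≤∣∣ : ∀ {d} (x : Vec ℕ d) i → lookup x i ≤ ∣ x ∣ᵥ
  lookup≤∣∣ (a ∷ x) Fin.zero    = m≤m+n a _
  lookup≤∣∣ (a ∷ x) (Fin.suc i) = ≤-trans (lookup≤∣∣ x i) (m≤n+m _ a)

  -- Integral polynomials are 1-Lipschitz, and `g` inherits this: in a box containing both points,
  -- one polynomial far enough in the sequence agrees with `g` modulo `p ^ k` at both.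
  InF-shift : ∀ {d} (g : Vec ℕ d → ℤₚ p) → InF p d g → ∀ k x s → g (x ⊕ s ⊛ p ^ k) ⟦ k ⟧ ≅ g x ⟦ k ⟧ [ p ^ k ]
  InF-shift g g∈F k x s with g∈F (∣ x ∣ᵥ + ∣ x ⊕ s ⊛ p ^ k ∣ᵥ)
  ... | Ps , converges with converges x (λ i → ≤-trans (lookup≤∣∣ x i) (m≤m+n _ _)) k
                          | converges (x ⊕ s ⊛ p ^ k) (λ i → ≤-trans (lookup≤∣∣ (x ⊕ s ⊛ p ^ k) i) (m≤n+m _ ∣ x ∣ᵥ)) k
  ...   | J , close | J' , close' = ≅-trans (≅-sym (∈p^⇒≅ _ _ k (close' (J + J') (m≤n+m J' J))))
    (≅-trans (evalM-shift k (Ps (J + J')) x s) (∈p^⇒≅ _ _ k (close (J + J') (m≤m+n J J'))))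

  -- The inverses found level by level are compatible, because an inverse modulo `p ^ k` is unique.
  ι-unit : Prime p → ∀ {w} → ¬ p ∣ w → Unit p (ιℕ p w)
  ι-unit pr {w} p∤w = fromApprox p inv , ≅⇒≈ (λ k → ≅-trans (approx-* (ιℕ p w) (fromApprox p inv) k)
    (≅-trans (≅-* (approx-ι w k) (approx-fromApprox inv compat k)) (≅-trans (inv-* k) (≅-sym (approx-ι 1 k)))))
    where
    inv : ℕ → ℕ
    inv k = proj₁ (inverse pr p∤w k)
    inv-* : ∀ k → w * inv k ≅ 1 [ p ^ k ]
    inv-* k = proj₂ (inverse pr p∤w k)
    compat : Compatible inv
    compat k = ≅-cancel-unit w (inv-* k) (≅-trans (lower k (inv-* (suc k))) (≅-sym (inv-* k)))

-- Translation to p-adic numbers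

open import Data.Integer as ℤ using (ℤ; +_; _-_) renaming (_*_ to _*ℤ_)
import Data.Integer.Properties as ℤ
open import Data.Rational as ℚ using (ℚ; _/_; mkℚ)
open import Data.Rational.Properties using (fromℚᵘ-cong; normalize-coprime)
open import Data.Rational.Unnormalised using (mkℚᵘ; *≡*)

-- Written in lowest terms with `mkℚ`, so that numerator and denominator compute and `ιℚ` yields
-- denominator 1 by reduction.
natℚ : ℕ → ℚ
natℚ n = mkℚ (+ n) 0 (coprime-sym (1-coprimeTo n))

/-natℚ : ∀ {n q} D .{{_ : NonZero D}} → n ≡ D * q → (+ n) / D ≡ natℚ q
/-natℚ {n} {q} (suc D) n≡Dq = trans
  (fromℚᵘ-cong {mkℚᵘ (+ n) D} {mkℚᵘ (+ q) 0} (*≡* (trans (ℤ.*-identityʳ (+ n))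
    (trans (cong +_ (trans n≡Dq (*-comm (suc D) q))) (ℤ.pos-* q (suc D))))))
  (normalize-coprime (coprime-sym (1-coprimeTo q)))

natℚ-+ : ∀ a b → natℚ a ℚ.+ natℚ b ≡ natℚ (a + b)
natℚ-+ a b = trans (cong (_/ 1) (cong₂ ℤ._+_ (ℤ.*-identityʳ (+ a)) (ℤ.*-identityʳ (+ b))))
  (/-natℚ 1 (sym (*-identityˡ (a + b))))

module _ {p : ℕ} .{{_ : NonZero p}} (pr : Prime p) where
  open PrimePart {p} pr

  -- The exponent counts the multiples of `p` among `M + 1`, ..., `M + l`. The digit formulas for
  -- `M !` and `(l + M) !` give this power in `unit! M * rise M l`, and `unit! M` is prime to `p`.
  rise-∣ : ∀ M l → p ^ ((l + M % p) /ℕ p) ∣ rise M l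
  rise-∣ M l = coprime-divisor (coprime-sym (∤⇒coprime-^ pr (∤unit! M) t))
    (subst (p ^ t ∣_) (sym ratio) (∣m⇒∣m*n (unit! (l + M)) (m∣m*n (rise m t))))
    where
    open ≡-Reasoning
    r = M % p
    m = M /ℕ p
    t = (l + r) /ℕ p
    M≡ : M ≡ r + m * p
    M≡ = m≡m%n+[m/n]*n M p
    l+M≡ : l + M ≡ (l + r) + m * p
    l+M≡ = trans (cong (_+_ l) M≡) (sym (+-assoc l r (m * p)))
    ring₁ : ∀ a b c d → a * b * (c * d) ≡ a * b * c * d
    ring₁ = solve-∀
    ring₂ : ∀ a b c → a * (b * c) ≡ a * b * c
    ring₂ = solve-∀
    ratio : unit! M * rise M l ≡ carryFactor m t * unit! (l + M)
    ratio = *-cancelˡ-≡ _ _ (p ^ m * m !) {{m*n≢0 _ _ {{m^n≢0 p m}} {{m !≢0}}}} (begin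
      p ^ m * m ! * (unit! M * rise M l)
        ≡⟨ ring₁ (p ^ m) (m !) (unit! M) (rise M l) ⟩
      p ^ m * m ! * unit! M * rise M l
        ≡⟨ cong (_* rise M l) (trans (cong (λ i → p ^ m * m ! * unit! i) M≡)
             (trans (sym (!-digit m r (m%n<n M p))) (cong _! (sym M≡)))) ⟩
      M ! * rise M l
        ≡⟨ !-rise l M ⟨
      (l + M) !
        ≡⟨ cong _! l+M≡ ⟩
      (l + r + m * p) !
        ≡⟨ !-digits (l + r) m ⟩
      p ^ m * (m ! * (carryFactor m t * unit! (l + r + m * p)))
        ≡⟨ cong (λ i → p ^ m * (m ! * (carryFactor m t * unit! i))) (sym l+M≡) ⟩
      p ^ m * (m ! * (carryFactor m t * unit! (l + M)))
        ≡⟨ ring₂ (p ^ m) (m !) (carryFactor m t * unit! (l + M)) ⟩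
      p ^ m * m ! * (carryFactor m t * unit! (l + M)) ∎)

module _ {p : ℕ} .{{_ : NonZero p}} where
  open Approximation p

  -- The fraction has value `s`, tested after clearing its denominator; `Frac` is never reduced, so
  -- that denominator may be divisible by `p`.
  Represents : ℕ → Frac p → ℕ → Set
  Represents k y s = num y ⟦ k ⟧ ≅ den y * s [ p ^ k ]

  represents-+ : ∀ k y y' {s s'} → Represents k y s → Represents k y' s' → Represents k (_+F_ p y y') (s + s')
  represents-+ k (x /ₚ a) (x' /ₚ a') {s} {s'} r r' = ≅-trans (approx-+ _ _ k)
    (≅-trans (≅-+ (≅-trans (approx-* x (ιℕ p a') k) (≅-* r (approx-ι a' k)))
                  (≅-trans (approx-* x' (ιℕ p a) k) (≅-* r' (approx-ι a k))))
      (≅-reflexive (ring a s a' s')))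
    where
    ring : ∀ a s b t → a * s * b + b * t * a ≡ a * b * (s + t)
    ring = solve-∀

  module _ {A : Set} (F : A → Frac p) where

    sumF : List A → Frac p
    sumF xs = List.foldr (_+F_ p) (0F p) (List.map F xs)

    represents-∑ : ∀ k {φ : A → ℕ} → (∀ x → Represents k (F x) (φ x)) → ∀ xs → Represents k (sumF xs) (list∑ φ xs)
    represents-∑ k {φ} r []       = approx-ι 0 k
    represents-∑ k {φ} r (x ∷ xs) = represents-+ k (F x) (sumF xs) {φ x} {list∑ φ xs} (r x) (represents-∑ k r xs)

    den-∑ : (∀ x → den (F x) ≡ 1) → ∀ xs → den (sumF xs) ≡ 1
    den-∑ den≡1 []       = refl
    den-∑ den≡1 (x ∷ xs) = cong₂ _*_ (den≡1 x) (den-∑ den≡1 xs)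

module _ {p : ℕ} .{{_ : NonZero p}} (pr : Prime p) {d u l : ℕ}
         (e : Vec (Vec ℕ d) u) (ks : Vec (Fin d) l)
         (balanced : vsum e ≡ vsum (unitTuple ks)) (dominating : Dominating e) where
  open Approximation p
  open PrimePart {p} pr
  open Valuations {p} pr e ks balanced dominating

  private f = unitTuple ks

  𝔖≡ : ∀ m → 𝔖 e f m ≡ natℚ (S m)
  𝔖≡ m = go (compositions d m)
    where
    go : ∀ xs → List.foldr ℚ._+_ ℚ.0ℚ (List.map (𝒬 e f) xs) ≡ natℚ (list∑ Q xs)
    go []       = refl
    go (x ∷ xs) = trans (cong₂ ℚ._+_ (/-natℚ (QDen f x) {{QDen≢0 f x}} (QNum≡ x)) (go xs)) (natℚ-+ (Q x) (list∑ Q xs))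

  𝔖-Frac : ∀ m → ιℚ p (𝔖 e f m) ≡ (ιℕ p (S m) /ₚ 1)
  𝔖-Frac m = cong (ιℚ p) (𝔖≡ m)

  module Translation (F : ℕ → Frac p) (F≡ : ∀ m → F m ≡ (ιℕ p (S m) /ₚ 1)) where

    In𝒵⇒∣ : ∀ {v} → In𝒵 p F v → p ∣ S v
    In𝒵⇒∣ {v} (_ , Fv∈p) with subst (λ y → _∈F-p^_ℤₚ p y (+ 1)) (F≡ v) Fv∈p
    ... | y , Sv≈ = subst (_∣ S v) (*-identityʳ p) (≅0⇒∣ (≅-trans (≅-sym (approx-ι (S v) 1))
      (≅-trans (≈⇒≅ Sv≈ 1) (≅-trans (approx-* (ιℕ p (1 * p ^ 1)) y 1)
        (≅-*ʳ (y ⟦ 1 ⟧) (≅-trans (approx-ι (1 * p ^ 1) 1) (∣⇒≅0 (n∣m*n 1))))))))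

    count≤ : ∀ fuel n {a} → Count p (In𝒵 p F) (digitsAux p fuel n) a → a ≤ αFuel fuel n
    count≤ zero       n       cnil = z≤n
    count≤ (suc fuel) zero    cnil = z≤n
    count≤ (suc fuel) (suc n) (cyes ∈𝒵 c) = +-mono-≤ (≤-reflexive (sym (z-∣ (In𝒵⇒∣ ∈𝒵)))) (count≤ fuel _ c)
    count≤ (suc fuel) (suc n) (cno  _  c) = ≤-trans (count≤ fuel _ c) (m≤n+m _ _)

    αₚ≤α : ∀ n {a} → αₚ≡ p F n a → a ≤ α n
    -- The number 0 has the digit list `0 ∷ []`, while `α 0` is 0; this case is consistent because 0
    -- is not in 𝒵.
    αₚ≤α zero (cyes ∈𝒵 cnil) = ≤-reflexive (trans (sym (z-∣ (In𝒵⇒∣ ∈𝒵))) z0)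
    αₚ≤α zero (cno  _  cnil) = z≤n
    αₚ≤α (suc n) c = count≤ (suc n) (suc n) c

    module _ (q : ℕ) (P : Fin (suc q) → Poly p) (annihilates : Annihilates p q P F) where

      private
        record Summands (y : Frac p) : Set where
          constructor summands
          field
            summand : Fin (suc q) → Frac p
            sums-to : y ≡ List.foldr (_+F_ p) (0F p) (List.map summand (List.allFin (suc q)))

        -- names the local function of applyOp
        applyOp-summands : ∀ N → Summands (applyOp p q P F N)
        applyOp-summands N = summands _ refl

        summand : ∀ N → Fin (suc q) → Frac p
        summand N = Summands.summand (applyOp-summands N)

        den-summand : ∀ N k → den (summand N k) ≡ 1
        den-summand N k with toℕ k ≤? N
        ... | no  _ = refl
        ... | yes _ = cong den (F≡ (N ∸ toℕ k))

      module _ (L : ℕ) where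
        c : Fin (suc q) → ℕ → ℕ
        c k = evalMod L (P k)

        term-represents : ∀ N k → Represents L (summand N k) (term c N k)
        term-represents N k with toℕ k ≤? N
        ... | no  _ = approx-ι 0 L
        ... | yes _ = subst (λ y → Represents L (_⊙_ p (evalP p (P k) (ιℕ p M)) y) (c k M * S M)) (sym (F≡ M))
              (≅-trans (approx-* (evalP p (P k) (ιℕ p M)) (ιℕ p (S M)) L) (≅-trans
                (≅-* (approx-evalP (P k) M L) (approx-ι (S M) L))
                (≅-reflexive (sym (*-identityˡ (c k M * S M))))))
          where
          M = N ∸ toℕ k

        c-vanishes : ∀ N → list∑ (term c N) (List.allFin (suc q)) ≅ 0 [ p ^ L ]
        c-vanishes N = ≅-trans (≅-reflexive (sym (trans (cong (_* total) den≡1) (*-identityˡ total))))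
          (≅-trans (≅-sym (represents-∑ (summand N) L {term c N} (term-represents N) (List.allFin (suc q))))
            (≅-trans (≈⇒≅ (annihilates N) L) (approx-ι 0 L)))
          where
          total = list∑ (term c N) (List.allFin (suc q))
          den≡1 : den (sumF (summand N) (List.allFin (suc q))) ≡ 1
          den≡1 = den-∑ (summand N) (den-summand N) (List.allFin (suc q))

        c-unit : P₀UnitCondition p q P → ∀ w → 0 < w → w < p → Σ ℕ λ y → c Fin.zero w * y ≅ 1 [ p ^ L ]
        c-unit P₀-unit w 0<w w<p = y ⟦ L ⟧ , ≅-trans (≅-*ʳ (y ⟦ L ⟧) (≅-sym (approx-evalP (P Fin.zero) w L)))
          (≅-trans (≅-sym (approx-* (evalP p (P Fin.zero) (ιℕ p w)) y L)) (≅-trans (≈⇒≅ (proj₂ inv) L) (approx-ι 1 L)))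
          where
          p∤w : ¬ p ∣ w
          p∤w p∣w = <⇒≱ w<p (∣⇒≤ {{>-nonZero 0<w}} p∣w)
          inv : Unit p (evalP p (P Fin.zero) (ιℕ p w))
          inv = P₀-unit (ιℕ p w) (ι-unit pr p∤w)
          y : ℤₚ p
          y = proj₁ inv

        c-ideal : ∀ k G → _∈ideal_ p (P k) G → ∀ M → Σ ℕ λ r → c k M ≅ evalMod L G M * r [ p ^ L ]
        c-ideal k G (R , Pk≈GR) M = evalMod L R M ,
          ≅-trans (evalMod-≈P L M (P k) (mulP p G R) Pk≈GR) (evalMod-mulP L M G R)

      c-periodic : ∀ L k M s → c L k (M + s * p) ≅ c L k M [ p ]
      c-periodic L k M s = evalMod-cong L (P k) (shifts 0 s (+-identityʳ _))

      -- With `i = toℕ k ∸ 1`, the range `M + 1`, ..., `M + i` ends just below `w + n * p` and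
      -- contains `t` multiples of `p`, so each of the two copies of `R` in `prodSq` is divisible by
      -- `p ^ t`. One copy pays for the loss in `α n ≤ t + α (m /ℕ p)`; as `t` is positive, the
      -- other provides the extra factor.
      remoteI : ∀ n k w → _∈ideal_ p (P k) (prodSq p (toℕ k)) → 0 < w → w < toℕ k → toℕ k ≤ w + n * p →
        let M = w + n * p ∸ toℕ k in p ^ α M ∣ S M → p ^ suc (α n) ∣ c (suc (α n)) k M * S M
      remoteI n k w Pk∈ 0<w w<k k≤N p^α∣S = ≅∣ (≅-*ʳ (S M) (≅-trans c≅ (≅-*ʳ r (evalMod-prodSq (suc (α n)) M (toℕ k)))))
        (∣-trans (^-∣ p exponent) (subst (_∣ R * R * r * S M) (sym split)
          (*-pres-∣ (∣m⇒∣m*n r (*-pres-∣ p^t∣R p^t∣R)) p^α∣S)))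
        where
        M = w + n * p ∸ toℕ k
        ideal = c-ideal (suc (α n)) k (prodSq p (toℕ k)) Pk∈ M
        r = proj₁ ideal
        c≅ = proj₂ ideal
        i = toℕ k ∸ 1
        R = rise M i
        m = M /ℕ p
        t = n ∸ m
        split : p ^ (t + t + α M) ≡ p ^ t * p ^ t * p ^ α M
        split = trans (^-distribˡ-+-* p (t + t) (α M)) (cong (_* p ^ α M) (^-distribˡ-+-* p t t))
        M<n*p : M < n * p
        M<n*p = ≤-trans (∸-monoʳ-< w<k k≤N) (≤-reflexive (m+n∸m≡n w (n * p)))
        m<n : m < n
        m<n = m<n*o⇒m/o<n M<n*p
        n≡ : m + t ≡ n
        n≡ = m+[n∸m]≡n (<⇒≤ m<n)
        N≡ : w + n * p ≡ suc (i + M)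
        N≡ = trans (sym (m+[n∸m]≡n k≤N)) (cong (_+ M) (sym (m+[n∸m]≡n (≤-trans (s≤s z≤n) w<k))))
        t*p≤ : t * p ≤ i + M % p
        -- Since `w` is positive, `n * p` itself is at most `i + M` and counts among the multiples.
        t*p≤ = +-cancelʳ-≤ (m * p) (t * p) (i + M % p) (begin
          t * p + m * p         ≡⟨ *-distribʳ-+ p t m ⟨
          (t + m) * p           ≡⟨ cong (_* p) (trans (+-comm t m) n≡) ⟩
          n * p                 ≤⟨ s≤s⁻¹ (≤-trans (+-monoˡ-≤ (n * p) 0<w) (≤-reflexive N≡)) ⟩
          i + M                 ≡⟨ cong (_+_ i) (m≡m%n+[m/n]*n M p) ⟩
          i + (M % p + m * p)   ≡⟨ +-assoc i (M % p) (m * p) ⟨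
          i + M % p + m * p     ∎)
          where open ≤-Reasoning
        p^t∣R : p ^ t ∣ R
        p^t∣R = ∣-trans (^-∣ p (subst (_≤ (i + M % p) /ℕ p) (m*n/n≡m t p) (/-mono-≤ t*p≤ (≤-refl {p})))) (rise-∣ pr M i)
        exponent : suc (α n) ≤ t + t + α M
        exponent = begin
          suc (α n)             ≡⟨ cong (suc ∘ α) n≡ ⟨
          suc (α (m + t))       ≤⟨ s≤s (α-+ m t (m<n⇒0<n∸m m<n)) ⟩
          suc (t + α (m /ℕ p))  ≤⟨ +-mono-≤ (+-monoˡ-≤ t (m<n⇒0<n∸m m<n)) (≤-trans (α-/≤ m) (α-/≤ M)) ⟩
          t + t + α M           ∎
          where open ≤-Reasoning

      -- The only such term has `w = 1` and `k = 2`, so `M + 1` is the multiple of `p` closing the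
      -- previous block. The factor `X + 1` contributes one `p`, and the last digit `p - 1` of `M`,
      -- lying in 𝒵, compensates for the possible increase of the count at the next block.
      remoteII : ∀ n k w → _∈ideal_ p (P k) (X+ p 1) → toℕ k ≡ 2 → p ∣ S (p ∸ 1) → w ≡ 1 → toℕ k ≤ w + n * p →
        let M = w + n * p ∸ toℕ k in p ^ α M ∣ S M → p ^ suc (α n) ∣ c (suc (α n)) k M * S M
      remoteII zero    k w Pk∈ k≡2 p∣S w≡1 k≤N p^α∣S = ⊥-elim (<⇒≱ (s≤s (s≤s z≤n)) (subst₂ (λ i j → i ≤ j + 0) k≡2 w≡1 k≤N))
      remoteII (suc n) k w Pk∈ k≡2 p∣S w≡1 k≤N p^α∣S = ≅∣ (≅-*ʳ (S M) (≅-trans c≅ (≅-*ʳ r (evalMod-X+ (suc (α (suc n))) M 1))))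
        (∣-trans (^-∣ p exponent) (*-pres-∣ (∣m⇒∣m*n r p∣suc-M) p^α∣S))
        where
        M = w + suc n * p ∸ toℕ k
        ideal = c-ideal (suc (α (suc n))) k (X+ p 1) Pk∈ M
        r = proj₁ ideal
        c≅ = proj₂ ideal
        p≡ : 1 + (p ∸ 1) ≡ p
        p≡ = m+[n∸m]≡n (<⇒≤ 1<p)
        M≡ : M ≡ (p ∸ 1) + n * p
        M≡ = trans (cong₂ (λ i j → i + suc n * p ∸ j) w≡1 k≡2) (cong (λ i → i + n * p ∸ 1) (sym p≡))
        p∣suc-M : p ∣ suc M
        p∣suc-M = subst (p ∣_) (trans (cong (_+ n * p) (sym p≡)) (cong suc (sym M≡))) (n∣m*n (suc n))
        exponent : suc (α (suc n)) ≤ suc (α M)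
        exponent = s≤s (begin
          α (suc n)            ≤⟨ α-suc n ⟩
          suc (α (n /ℕ p))     ≤⟨ s≤s (α-/≤ n) ⟩
          suc (α n)            ≡⟨ cong (_+ α n) (z-∣ p∣S) ⟨
          z (p ∸ 1) + α n      ≡⟨ α-digit n (≤-reflexive p≡) ⟨
          α (p ∸ 1 + n * p)    ≡⟨ cong α M≡ ⟨
          α M                  ∎)
          where open ≤-Reasoning

      recurrence : TypeI p q P ⊎ (TypeII p q P × In𝒵 p F (p ∸ 1)) → ∀ n → Recurrence q n
      recurrence (inj₁ (P₀-unit , P∈)) n = record
        { c        = c (suc (α n))
        ; vanishes = c-vanishes (suc (α n))
        ; periodic = c-periodic (suc (α n))
        ; unit     = c-unit (suc (α n)) P₀-unit
        ; remote   = λ k w 0<w w<p w<k → remoteI n k w (P∈ k (≤-trans (s≤s 0<w) w<k)) 0<w w<k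
        }
      recurrence (inj₂ ((q≡2 , P₀-unit , P∈) , p-1∈𝒵)) n = record
        { c        = c (suc (α n))
        ; vanishes = c-vanishes (suc (α n))
        ; periodic = c-periodic (suc (α n))
        ; unit     = c-unit (suc (α n)) P₀-unit
        ; remote   = λ k w 0<w w<p w<k → remoteII n k w (P∈ k (k≡2 k 0<w w<k)) (k≡2 k 0<w w<k) (In𝒵⇒∣ p-1∈𝒵) (w≡1 k 0<w w<k)
        }
        where
        k≤2 : ∀ k → toℕ k ≤ 2
        k≤2 k = subst (toℕ k ≤_) q≡2 (s≤s⁻¹ (toℕ<n k))
        k≡2 : ∀ {w} k → 0 < w → w < toℕ k → toℕ k ≡ 2
        k≡2 k 0<w w<k = ≤-antisym (k≤2 k) (≤-trans (s≤s 0<w) w<k)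
        w≡1 : ∀ {w} k → 0 < w → w < toℕ k → w ≡ 1
        w≡1 k 0<w w<k = ≤-antisym (s≤s⁻¹ (≤-trans w<k (k≤2 k))) 0<w

  InF-Lipschitz : ∀ (g : Vec ℕ d → ℤₚ p) → InF p d g → ∀ j → Lipschitz j (λ x → g x ⟦ j ⟧)
  InF-Lipschitz g g∈F j k k≤j x s = ≅-trans (approx-≤ (g (x ⊕ s ⊛ p ^ k)) k≤j)
    (≅-trans (InF-shift g g∈F k x s) (≅-sym (approx-≤ (g x) k≤j)))

  module _ (g : Vec ℕ d → ℤₚ p) where

    -- The true value of `𝔖ᵍ`, whose formal denominator is the product of all the `QDen`.
    integralSum : List (Vec ℕ d) → ℤₚ p
    integralSum = List.foldr (λ x acc → _+ₚ_ p (_*ₚ_ p (ιℕ p (Q x)) (g x)) acc) (0ₚ p)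

    approx-integralSum : ∀ k xs → integralSum xs ⟦ k ⟧ ≅ list∑ (λ x → Q x * g x ⟦ k ⟧) xs [ p ^ k ]
    approx-integralSum k []       = approx-ι 0 k
    approx-integralSum k (x ∷ xs) = ≅-trans (approx-+ (_*ₚ_ p (ιℕ p (Q x)) (g x)) (integralSum xs) k)
      (≅-+ (≅-trans (approx-* (ιℕ p (Q x)) (g x) k) (≅-*ʳ (g x ⟦ k ⟧) (approx-ι (Q x) k))) (approx-integralSum k xs))

    𝔖ᵍ-represents : ∀ m k → Represents k (𝔖ᵍ p e f g m) (integralSum (compositions d m) ⟦ k ⟧)
    𝔖ᵍ-represents m k = ≅-trans (represents-∑ _ k {λ x → Q x * g x ⟦ k ⟧} summand (compositions d m))
      (≅-*ˡ (den (𝔖ᵍ p e f g m)) (≅-sym (approx-integralSum k (compositions d m))))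
      where
      summand : ∀ x → Represents k ((_*ₚ_ p (ιℕ p (QNum e x)) (g x)) /ₚ QDen f x) (Q x * g x ⟦ k ⟧)
      summand x = ≅-trans (approx-* (ιℕ p (QNum e x)) (g x) k)
        (≅-trans (≅-*ʳ (g x ⟦ k ⟧) (≅-trans (approx-ι (QNum e x) k) (≅-reflexive (QNum≡ x))))
          (≅-reflexive (*-assoc (QDen f x) (Q x) (g x ⟦ k ⟧))))

    -- For `a` zero the exponent is -1 and integrality suffices, with witness `p` times the value.
    -- Otherwise only the first `a - 1` digits of `g` matter, so the weight in the premise is
    -- truncated at that level.
    𝔖ᵍ-∈ : ∀ m a → (∀ j → a ≡ suc j → p ^ j ∣ 𝕊 (λ x → g x ⟦ j ⟧) m) → _∈F-p^_ℤₚ p (𝔖ᵍ p e f g m) ((+ a) - (+ 1))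
    𝔖ᵍ-∈ m zero _ = _*ₚ_ p (ιℕ p (p ^ 1)) Z , ≅⇒≈ (λ k →
      ≅-trans (approx-* (ιℕ p (p ^ 1)) (num R) k) (≅-trans (≅-* (approx-ι (p ^ 1) k) (𝔖ᵍ-represents m k))
        (≅-sym (≅-trans (approx-* (ιℕ p (den R)) (_*ₚ_ p (ιℕ p (p ^ 1)) Z) k) (≅-trans
          (≅-* (approx-ι (den R) k) (≅-trans (approx-* (ιℕ p (p ^ 1)) Z k) (≅-*ʳ (Z ⟦ k ⟧) (approx-ι (p ^ 1) k))))
          (≅-reflexive (ring (den R) (p ^ 1) (Z ⟦ k ⟧))))))))
      where
      R = 𝔖ᵍ p e f g m
      Z = integralSum (compositions d m)
      ring : ∀ a b c → a * (b * c) ≡ b * (a * c)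
      ring = solve-∀
    𝔖ᵍ-∈ m (suc j) p^j∣ = divideBy j Z , ≅⇒≈ (λ k →
      ≅-trans (𝔖ᵍ-represents m k) (≅-trans (≅-*ˡ (den R) (divideBy-≅ j Z p^j∣Z k))
        (≅-sym (≅-trans (approx-* (ιℕ p (den R * p ^ j)) (divideBy j Z) k)
          (≅-trans (≅-*ʳ (divideBy j Z ⟦ k ⟧) (approx-ι (den R * p ^ j) k))
            (≅-reflexive (*-assoc (den R) (p ^ j) (divideBy j Z ⟦ k ⟧))))))))
      where
      R = 𝔖ᵍ p e f g m
      Z = integralSum (compositions d m)
      p^j∣Z : p ^ j ∣ Z ⟦ j ⟧
      p^j∣Z = ≅∣ (approx-integralSum j (compositions d m)) (p^j∣ j refl)

theorem1 : (d : ℕ) → 1 ≤ d → (p : ℕ) → .{{_ : NonZero p}} → Prime p →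
    (u v : ℕ) (e : Vec (Vec ℕ d) u) (ks : Vec (Fin d) v) →
    Disjoint e (unitTuple ks) →
    vsum e ≡ vsum (unitTuple ks) →
    Admissible 2 e →
    (q : ℕ) (P : Fin (suc q) → Poly p) →
    Annihilates p q P (λ m → ιℚ p (𝔖 e (unitTuple ks) m)) →
    (TypeI p q P ⊎ (TypeII p q P × In𝒵 p (λ m → ιℚ p (𝔖 e (unitTuple ks) m)) (p ∸ 1))) →
    (n : ℕ) (g : Vec ℕ d → ℤₚ p) → InF p d g →
    (a : ℕ) → αₚ≡ p (λ m → ιℚ p (𝔖 e (unitTuple ks) m)) n a →
    (Σ ℤ λ z → 𝔖 e (unitTuple ks) n ≡ (+ (p ^ a) *ℤ z) / 1)
    × _∈F-p^_ℤₚ p (𝔖ᵍ p e (unitTuple ks) g n) ((+ a) - (+ 1))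
theorem1 d 1≤d p pr u v e ks _ balanced admissible q P annihilates types n g g∈F a counted =
  (+ quotient p^a∣S , trans (𝔖≡ pr e ks balanced dominating n)
    (trans (sym (/-natℚ 1 refl)) (cong (_/ 1) (trans (cong +_ S≡) (ℤ.pos-* (p ^ a) (quotient p^a∣S)))))) ,
  𝔖ᵍ-∈ pr e ks balanced dominating g n a (λ j a≡ → proj₁ bounds j
    -- The exponent loses one because the weighted bound reaches only `α (n /ℕ p)`, and `α n`
    -- exceeds this by at most one.
    (s≤s⁻¹ (≤-trans (≤-reflexive (sym a≡)) (≤-trans a≤α (α≤1+α-/ n))))
    _ (InF-Lipschitz pr e ks balanced dominating g g∈F j))
  where
  dominating = admissible⇒dominating e 1≤d admissible
  open Valuations pr e ks balanced dominating
  open Translation pr e ks balanced dominating (λ m → ιℚ p (𝔖 e (unitTuple ks) m)) (𝔖-Frac pr e ks balanced dominating)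
  bounds = valuations (recurrence q P annihilates types) n
  a≤α : a ≤ α n
  a≤α = αₚ≤α n counted
  p^a∣S : p ^ a ∣ S n
  p^a∣S = ∣-trans (^-∣ p a≤α) (proj₂ bounds)
  S≡ : 1 * S n ≡ p ^ a * quotient p^a∣S
  S≡ = trans (*-identityˡ (S n)) (trans (_∣_.equality p^a∣S) (*-comm (quotient p^a∣S) (p ^ a)))
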